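{- Let $\alpha\in(0,1)$ be an irrational number with bounded partial quotients, and let $s_\alpha$ be a Sturmian word of angle $\alpha$. Then there exists a positive constant $C$ such that for every sufficiently large $n$, $\sum_{m\le n}\mathit{ASF}_{s_\alpha}(m)\ge Cn^2$.
   Context: Alphabet $\{a,b\}$; $\{x\}=x-\lfloor x\rfloor$. For irrational $\alpha\in(0,1)$ and $\rho\in[0,1)$, the Sturmian word $s_{\alpha,\rho}=c_0c_1\cdots$ has $c_m=b$ if $\{\rho+m\alpha\}\in[0,1-\alpha)$ and $c_m=a$ otherwise (or with intervals $(0,1-\alpha]$ and $(1-\alpha,1]$); all these have the same set of factors, and $s_\alpha$ denotes any of them. $\alpha$ has bounded partial quotients if the sequence $(a_i)$ of its simple continued fraction expansion $\alpha=[a_0;a_1,a_2,\dots]$ is bounded. An abelian square is a word $v_1v_2$ with $v_1,v_2$ having the same numbers of each letter; $\mathit{ASF}_w(m)$ is the number of distinct factors of $w$ of length $m$ that are abelian squares. -}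

module Defs where

open import Data.Nat as ℕ using (ℕ; zero; suc; _⊔_)
import Data.Nat.Properties as ℕ
open import Data.Integer as ℤ using (ℤ; +_)
open import Data.Rational as ℚ using (ℚ; 0ℚ; 1ℚ; ½; ∣_∣)
import Data.Rational.Properties as ℚ
open import Data.Rational.Solver using (module +-*-Solver)
open import Data.List using (List; _++_; length; applyUpTo; filter)
open import Data.List.Membership.Propositional using (_∈_)
open import Data.List.Relation.Unary.Unique.Propositional using (Unique)
open import Data.Product using (Σ; ∃; ∃-syntax; _×_; _,_)
open import Data.Sum using (_⊎_)
open import Function using (_∘_; _⇔_)
open import Relation.Binary using (DecidableEquality)
open import Relation.Binary.PropositionalEquality using (_≡_; refl; sym; trans; cong; subst; subst₂)
open import Relation.Nullary using (¬_; yes; no)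

------------------------------------------------------------------------
-- Real numbers as Cauchy sequences of rationals

IsCauchy : (ℕ → ℚ) → Set
IsCauchy x = ∀ ε → 0ℚ ℚ.< ε →
  ∃[ N ] ∀ m n → N ℕ.≤ m → N ℕ.≤ n → ∣ x m ℚ.- x n ∣ ℚ.< ε

record ℝ : Set where
  constructor mkℝ
  field
    seq    : ℕ → ℚ
    cauchy : IsCauchy seq

open ℝ public

infix  4 _<_ _≤_ _≈_
infixl 6 _+_ _-_
infixr 7 _•_
infix  8 -_

_<_ : ℝ → ℝ → Set
x < y = ∃[ ε ] 0ℚ ℚ.< ε × ∃[ N ] ∀ n → N ℕ.≤ n → seq x n ℚ.+ ε ℚ.≤ seq y n

_≤_ : ℝ → ℝ → Set
x ≤ y = ¬ (y < x)

_≈_ : ℝ → ℝ → Set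
x ≈ y = x ≤ y × y ≤ x

fromℚ : ℚ → ℝ
fromℚ q = mkℝ (λ _ → q) λ ε 0<ε →
  0 , λ _ _ _ _ → subst (λ d → ∣ d ∣ ℚ.< ε) (sym (ℚ.+-inverseʳ q)) 0<ε

fromℤ : ℤ → ℝ
fromℤ k = fromℚ (k ℚ./ 1)

fromℕ : ℕ → ℝ
fromℕ n = fromℤ (+ n)

0ℝ 1ℝ : ℝ
0ℝ = fromℚ 0ℚ
1ℝ = fromℚ 1ℚ

_+_ : ℝ → ℝ → ℝ
mkℝ x cx + mkℝ y cy = mkℝ (λ n → x n ℚ.+ y n) proof
  where
  open +-*-Solver

  interchange : ∀ p q r s → (p ℚ.+ q) ℚ.- (r ℚ.+ s) ≡ (p ℚ.- r) ℚ.+ (q ℚ.- s)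
  interchange = solve 4 (λ p q r s →
    (p :+ q) :- (r :+ s) := (p :- r) :+ (q :- s)) refl

  halves : ∀ ε → ½ ℚ.* ε ℚ.+ ½ ℚ.* ε ≡ ε
  halves ε = trans (sym (ℚ.*-distribʳ-+ ε ½ ½)) (ℚ.*-identityˡ ε)

  proof : IsCauchy (λ n → x n ℚ.+ y n)
  proof ε 0<ε with cx (½ ℚ.* ε) (ℚ.*-monoʳ-<-pos ½ 0<ε)
                 | cy (½ ℚ.* ε) (ℚ.*-monoʳ-<-pos ½ 0<ε)
  ... | M , hx | N , hy = M ⊔ N , λ m n m≥ n≥ →
    subst₂ ℚ._<_ (cong ∣_∣ (sym (interchange (x m) (y m) (x n) (y n)))) (halves ε)
      (ℚ.≤-<-trans (ℚ.∣p+q∣≤∣p∣+∣q∣ (x m ℚ.- x n) (y m ℚ.- y n))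
        (ℚ.+-mono-<
          (hx m n (ℕ.m⊔n≤o⇒m≤o M N m≥) (ℕ.m⊔n≤o⇒m≤o M N n≥))
          (hy m n (ℕ.m⊔n≤o⇒n≤o M N m≥) (ℕ.m⊔n≤o⇒n≤o M N n≥))))

-_ : ℝ → ℝ
- mkℝ x cx = mkℝ (λ n → ℚ.- x n) λ ε 0<ε → let N , h = cx ε 0<ε in
  N , λ m n m≥ n≥ → subst (ℚ._< ε) (flip-abs (x m) (x n)) (h m n m≥ n≥)
  where
  flip-abs : ∀ p q → ∣ p ℚ.- q ∣ ≡ ∣ ℚ.- p ℚ.- ℚ.- q ∣
  flip-abs p q = trans (sym (ℚ.∣-p∣≡∣p∣ (p ℚ.- q))) (cong ∣_∣ (ℚ.neg-distrib-+ p (ℚ.- q)))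

_-_ : ℝ → ℝ → ℝ
x - y = x + (- y)

_•_ : ℕ → ℝ → ℝ
zero  • x = 0ℝ
suc n • x = x + n • x

Irrational : ℝ → Set
Irrational α = ¬ (∃[ q ] α ≈ fromℚ q)

_⟶_ : (ℕ → ℚ) → ℝ → Set
c ⟶ x = ∀ ε → 0ℚ ℚ.< ε →
  ∃[ N ] ∀ n → N ℕ.≤ n → fromℚ (c n ℚ.- ε) < x × x < fromℚ (c n ℚ.+ ε)

------------------------------------------------------------------------
-- Continued fractions

-- The value at 0ℚ is never used for a simple continued fraction, whose
-- tails are all positive.
recip : ℚ → ℚ
recip q with q ℚ.≟ 0ℚ
... | yes _   = 0ℚ
... | no q≢0 = ℚ.1/_ q {{ℚ.≢-nonZero q≢0}}

-- convergent a n = [a₀; a₁, …, aₙ]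
convergent : (ℕ → ℤ) → ℕ → ℚ
convergent a zero    = a 0 ℚ./ 1
convergent a (suc n) = a 0 ℚ./ 1 ℚ.+ recip (convergent (a ∘ suc) n)

_HasSimpleContinuedFraction_ : ℝ → (ℕ → ℤ) → Set
α HasSimpleContinuedFraction a = (∀ i → + 1 ℤ.≤ a (suc i)) × convergent a ⟶ α

BoundedPartialQuotients : ℝ → Set
BoundedPartialQuotients α =
  ∃[ a ] α HasSimpleContinuedFraction a × ∃[ M ] ∀ i → ℤ.∣ a i ∣ ℕ.≤ M

------------------------------------------------------------------------
-- Sturmian words

data Letter : Set where
  a b : Letter

_≟_ : DecidableEquality Letter
a ≟ a = yes refl
a ≟ b = no λ ()
b ≟ a = no λ ()
b ≟ b = yes refl

InfiniteWord : Set
InfiniteWord = ℕ → Letter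

_IsFloorOf_ : ℤ → ℝ → Set
k IsFloorOf x = fromℤ k ≤ x × x < fromℤ (k ℤ.+ + 1)

-- The fractional part of x lies in I. The floor is a relation because it is
-- not computable from a Cauchy sequence.
FracIn : (ℝ → Set) → ℝ → Set
FracIn I x = ∃[ k ] k IsFloorOf x × I (x - fromℤ k)

[_,_⟩ ⟨_,_] : ℝ → ℝ → ℝ → Set
[ l , u ⟩ x = l ≤ x × x < u
⟨ l , u ] x = l < x × x ≤ u

RotationWord : (I : ℝ → Set) (α ρ : ℝ) → InfiniteWord → Set
RotationWord I α ρ c = ∀ m →
  (FracIn I (ρ + m • α) → c m ≡ b) × (¬ FracIn I (ρ + m • α) → c m ≡ a)

-- In the second convention the circle is represented by ⟨0,1], so the integer
-- points belong to ⟨1-α,1]; they have fractional part 0, which is outside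
-- ⟨0,1-α], and so receive the letter a as required.
IsSturmian : ℝ → InfiniteWord → Set
IsSturmian α s = ∃[ ρ ] [ 0ℝ , 1ℝ ⟩ ρ ×
  (RotationWord [ 0ℝ , 1ℝ - α ⟩ α ρ s ⊎ RotationWord ⟨ 0ℝ , 1ℝ - α ] α ρ s)

------------------------------------------------------------------------
-- Abelian squares

_IsFactorOf_ : List Letter → InfiniteWord → Set
w IsFactorOf s = ∃[ i ] w ≡ applyUpTo (λ j → s (i ℕ.+ j)) (length w)

occurrences : Letter → List Letter → ℕ
occurrences c = length ∘ filter (c ≟_)

AbelianSquare : List Letter → Set
AbelianSquare w = ∃[ u ] ∃[ v ] w ≡ u ++ v × (∀ c → occurrences c u ≡ occurrences c v)

HasCardinality : {A : Set} → (A → Set) → ℕ → Set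
HasCardinality P k = ∃[ xs ] Unique xs × (∀ x → (x ∈ xs) ⇔ P x) × length xs ≡ k

-- f is the function ASF of s: f m is the number of distinct factors of s of
-- length m that are abelian squares.
IsASF : InfiniteWord → (ℕ → ℕ) → Set
IsASF s f = ∀ m →
  HasCardinality (λ w → length w ≡ m × w IsFactorOf s × AbelianSquare w) (f m)

{-# OPTIONS --safe #-}

-- The number h n of letters a among the first n letters changes over j steps by
-- an amount within 1 of jα. If P/Q < α < P′/Q′ are Farey neighbours, this
-- pins α down enough for two consequences. First, a factor shorter than Q and Q′
-- that occurs at i ≥ Q, Q′ also occurs at i - Q or i - Q′, so the factors of each
-- length can be listed. Second, no period shorter than Q and Q′ persists for
-- max(Q, Q′) steps; as bounded partial quotients provide neighbours with
-- n ≤ Q, Q′ ≤ Kn for every n, the factors of length ℓ at ℓ/K consecutive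
-- positions are distinct.
--
-- Abelian squares are frequent: the numbers of letters a in four consecutive
-- blocks of length m take at most two values, and a binary word of length four
-- contains a square. So of the abelian squares with halves m or 2m one starts at
-- i, i + m or i + 2m, for every i. Hence 3 ASF(2m) + ASF(4m) ≥ L whenever
-- KL ≤ m, and summation over m gives the quadratic bound.
module Submission where

open import Algebra.Bundles using (module CommutativeRing)
import Algebra.Solver.Ring
import Algebra.Solver.Ring.AlmostCommutativeRing as ACR
open import Data.Empty using (⊥; ⊥-elim)
open import Data.Fin as Fin using (Fin; toℕ)
import Data.Fin.Properties as Fin
open import Data.Integer as ℤ using (ℤ; +_; -[1+_]; 0ℤ; 1ℤ; +≤+)
import Data.Integer.Properties as ℤ
open import Data.Integer.Tactic.RingSolver using (solve-∀)
open import Data.List using (List; map; sum; upTo; []; _∷_; _++_; [_]; length; applyUpTo; filter; allFin; take; drop; deduplicate)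
open import Data.List.Membership.Propositional using (_∈_)
open import Data.List.Membership.Propositional.Properties
import Data.List.Properties as List
open import Data.List.Relation.Binary.Subset.Propositional using (_⊆_)
open import Data.List.Relation.Unary.All as All using ()
open import Data.List.Relation.Unary.Any using (here; there)
import Data.List.Relation.Unary.Unique.DecPropositional.Properties as DecUnique
open import Data.List.Relation.Unary.Unique.Propositional using (Unique; []; _∷_)
import Data.List.Relation.Unary.Unique.Propositional.Properties as Unique
open import Data.Maybe as Maybe using (Maybe)
open import Data.Nat as ℕ using (ℕ; zero; suc; z≤n; s≤s)
import Data.Nat.Coprimality as Coprimality
import Data.Nat.DivMod as ℕ
open import Data.Nat.Induction using (<-rec)
import Data.Nat.ListAction as ListAction
open import Data.Nat.ListAction.Properties using (sum-++)
import Data.Nat.Properties as ℕ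
open import Data.Nat.Solver using (module +-*-Solver)
open import Data.Product using (∃; ∃-syntax; _×_; _,_; proj₁; proj₂)
open import Data.Rational as ℚ using (ℚ; 0ℚ; 1ℚ; ½; ∣_∣; mkℚ; *≤*)
import Data.Rational.Properties as ℚ
import Data.Rational.Solver as ℚ-Solver
open import Data.Sum using (_⊎_; inj₁; inj₂; [_,_]′)
open import Function using (_∘_; case_of_; mk⇔; Injective)
open import Relation.Binary using (Tri; tri<; tri≈; tri>)
open import Relation.Binary.PropositionalEquality using (_≡_; _≢_; refl; sym; trans; cong; cong₂; subst; subst₂; module ≡-Reasoning)
open import Relation.Nullary using (¬_; Dec; yes; no; contradiction)
open import Relation.Nullary.Decidable as Dec using (_×-dec_; dec⇒maybe)
open import Relation.Unary using (Decidable)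
open import Relation.Unary.Properties using (_∪?_)

-- Farey neighbours

-- The statement asks for the function `ASF` itself, with complete lists of words, whereas the floor
-- of a point of the orbit is in general known only up to double negation. What survives is whatever
-- is a negation or decidable. As `_≤_` on the reals is a negation, the bounds of the height
-- increments by jα hold outright, and comparison with rational neighbours turns them into the
-- decidable integer inequalities of `Farey`. From there on neither α nor the interval convention
-- appears.
--
-- Irrationality makes these inequalities strict, and the strictness is indispensable: the
-- contradictions below are combinations of nonnegative integers that sum to exactly -1, without
-- slack.

module FareyPairs where
  open import Data.Integer using (_+_; _-_; _*_; _≤_; -_)

  0≤+ : ∀ {x y} → 0ℤ ≤ x → 0ℤ ≤ y → 0ℤ ≤ x + y
  0≤+ = ℤ.+-mono-≤

  0≤* : ∀ {x} n → 0ℤ ≤ x → 0ℤ ≤ + n * x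
  0≤* {x} n 0≤x = subst (_≤ + n * x) (ℤ.*-zeroʳ (+ n)) (ℤ.*-monoˡ-≤-nonNeg (+ n) 0≤x)

  0≤n : ∀ n → 0ℤ ≤ + n
  0≤n n = +≤+ z≤n

  0≰-1 : ∀ {x} → 0ℤ ≤ x → x ≢ - 1ℤ
  0≰-1 0≤x refl with 0≤x
  ... | ()

  0≤*-cancel : ∀ {x} n → 0ℤ ≤ + n * x - 1ℤ → 0ℤ ≤ x - 1ℤ
  0≤*-cancel {+ zero} n 0≤nx-1 = ⊥-elim (0≰-1 0≤nx-1 (cong (_- 1ℤ) (ℤ.*-zeroʳ (+ n))))
  0≤*-cancel {+ suc m} n _ = 0≤n m
  0≤*-cancel { -[1+ m ]} zero ()
  0≤*-cancel { -[1+ m ]} (suc n) ()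

  -- The fractions P/Q < P′/Q′ are Farey neighbours, and P/Q < (c + 1)/j and
  -- (c - 1)/j < P′/Q′ for every increment c of h over j steps; the strict
  -- inequalities of integers are stated as nonnegativity of a difference.
  record Farey (h : ℕ → ℤ) (P : ℤ) (Q : ℕ) (P′ : ℤ) (Q′ : ℕ) : Set where
    field
      det   : P′ * + Q - P * + Q′ ≡ 1ℤ
      lower : ∀ i j → 0ℤ ≤ + Q * (h (i ℕ.+ j) - h i + 1ℤ) - P * + j - 1ℤ
      upper : ∀ i j → 0ℤ ≤ P′ * + j - + Q′ * (h (i ℕ.+ j) - h i - 1ℤ) - 1ℤ

    lower′ : ∀ {u v} j → u ℕ.+ j ≡ v → 0ℤ ≤ + Q * (h v - h u + 1ℤ) - P * + j - 1ℤ
    lower′ j refl = lower _ j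

    upper′ : ∀ {u v} j → u ℕ.+ j ≡ v → 0ℤ ≤ P′ * + j - + Q′ * (h v - h u - 1ℤ) - 1ℤ
    upper′ j refl = upper _ j

  open Farey

  private variable
    h : ℕ → ℤ
    P P′ : ℤ
    Q Q′ : ℕ

  -- Reflection of the number line turns neighbours of α into neighbours of -α, so every bound from
  -- below also gives one from above. This is why `h` takes integer values.
  flip : Farey h P Q P′ Q′ → Farey (-_ ∘ h) (- P′) Q′ (- P) Q
  flip {h} {P} {Q} {P′} {Q′} F = record
    { det   = trans (eq₁ P (+ Q) P′ (+ Q′)) (F .det)
    ; lower = λ i j → subst (0ℤ ≤_) (eq₂ P′ (+ Q′) (h (i ℕ.+ j)) (h i) (+ j)) (F .upper i j)
    ; upper = λ i j → subst (0ℤ ≤_) (eq₃ P (+ Q) (h (i ℕ.+ j)) (h i) (+ j)) (F .lower i j)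
    }
    where
    eq₁ : ∀ P Q P′ Q′ → - P * Q′ - - P′ * Q ≡ P′ * Q - P * Q′
    eq₁ = solve-∀
    eq₂ : ∀ P Q x y j → P * j - Q * (x - y - 1ℤ) - 1ℤ ≡ Q * (- x - - y + 1ℤ) - - P * j - 1ℤ
    eq₂ = solve-∀
    eq₃ : ∀ P Q x y j → Q * (x - y + 1ℤ) - P * j - 1ℤ ≡ - P * j - Q * (- x - - y - 1ℤ) - 1ℤ
    eq₃ = solve-∀

  shift : ∀ k → Farey h P Q P′ Q′ → Farey (h ∘ (k ℕ.+_)) P Q P′ Q′
  shift k F = record
    { det   = F .det
    ; lower = λ i j → lower′ F j (ℕ.+-assoc k i j)
    ; upper = λ i j → upper′ F j (ℕ.+-assoc k i j)
    }

  -- For j = Q the bound `lower` says Q (c + 1 - P) > 0 for the increment c, and Q can be cancelled.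
  increment≥ : Farey h P Q P′ Q′ → ∀ i → 0ℤ ≤ h (i ℕ.+ Q) - h i - P
  increment≥ {h} {P} {Q} F i = subst (0ℤ ≤_) (eq₂ (h (i ℕ.+ Q)) (h i) P)
    (0≤*-cancel Q (subst (0ℤ ≤_) (eq₁ P (+ Q) (h (i ℕ.+ Q)) (h i)) (F .lower i Q)))
    where
    eq₁ : ∀ P Q x y → Q * (x - y + 1ℤ) - P * Q - 1ℤ ≡ Q * (x - y + 1ℤ - P) - 1ℤ
    eq₁ = solve-∀
    eq₂ : ∀ x y P → x - y + 1ℤ - P - 1ℤ ≡ x - y - P
    eq₂ = solve-∀

  0≤⊎0≤neg : ∀ x → 0ℤ ≤ x ⊎ 0ℤ ≤ - x - 1ℤ
  0≤⊎0≤neg (+ n)    = inj₁ (0≤n n)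
  0≤⊎0≤neg -[1+ n ] = inj₂ (0≤n n)

  zero∨positive : ∀ {x} → 0ℤ ≤ x → x ≡ 0ℤ ⊎ 0ℤ ≤ x - 1ℤ
  zero∨positive {+ zero}  _ = inj₁ refl
  zero∨positive {+ suc n} _ = inj₂ (0≤n n)

  <⇒0≤ : ∀ {m n} → m ℕ.< n → 0ℤ ≤ + n - + m - 1ℤ
  <⇒0≤ {m} {n} m<n = subst (0ℤ ≤_) (eq (+ n) (+ m)) (ℤ.i≤j⇒0≤j-i (+≤+ m<n))
    where
    eq : ∀ n m → n - (1ℤ + m) ≡ n - m - 1ℤ
    eq = solve-∀

  -- Increments c and c′ with c′ ≥ c + 2 would give P/Q < (c + 1)/j ≤ (c′ - 1)/j < P′/Q′, but a
  -- fraction strictly between Farey neighbours has denominator at least Q + Q′. The sum below is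
  -- this argument with denominators cleared.
  increments-close : Farey h P Q P′ Q′ → ∀ i i′ {j} → j ℕ.< Q →
    0ℤ ≤ h (i ℕ.+ j) - h i + 1ℤ - (h (i′ ℕ.+ j) - h i′)
  increments-close {h} {P} {Q} {P′} {Q′} F i i′ {j} j<Q
    with 0≤⊎0≤neg (h (i ℕ.+ j) - h i + 1ℤ - (h (i′ ℕ.+ j) - h i′))
  ... | inj₁ p = p
  ... | inj₂ p = ⊥-elim (0≰-1
    (0≤+ (0≤+ (0≤+ (0≤+ (0≤* Q (F .upper i′ j)) (0≤* Q (0≤* Q′ p))) (0≤* Q′ (F .lower i j)))
      (<⇒0≤ j<Q)) (0≤n Q′))
    (trans (eq P (+ Q) P′ (+ Q′) (h (i ℕ.+ j)) (h i) (h (i′ ℕ.+ j)) (h i′) (+ j))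
      (trans (cong (λ D → + j * D - + j - 1ℤ) (F .det)) (eq′ (+ j)))))
    where
    eq : ∀ P Q P′ Q′ x y x′ y′ j →
      Q * (P′ * j - Q′ * (x′ - y′ - 1ℤ) - 1ℤ) + Q * (Q′ * (- (x - y + 1ℤ - (x′ - y′)) - 1ℤ))
        + Q′ * (Q * (x - y + 1ℤ) - P * j - 1ℤ) + (Q - j - 1ℤ) + Q′
      ≡ j * (P′ * Q - P * Q′) - j - 1ℤ
    eq = solve-∀
    eq′ : ∀ j → j * 1ℤ - j - 1ℤ ≡ - 1ℤ
    eq′ = solve-∀

  -- Positions u and v less than Q and Q′ apart cannot both be exceptional, u by
  -- an increment above P over Q steps and v by one below P′ over Q′ steps: the
  -- bounds on the increments between u, v, k and l would contradict det.
  exceptions-apart′ : Farey h P Q P′ Q′ → ∀ {u v} k l d → k ℕ.+ Q ≡ u → u ℕ.+ d ≡ v → l ℕ.+ Q′ ≡ v →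
    d ℕ.< Q′ → 0ℤ ≤ h u - h k - P - 1ℤ → 0ℤ ≤ P′ - (h v - h l) - 1ℤ → ⊥
  exceptions-apart′ {h} {P} {Q} {P′} {Q′} F {u} {v} k l d k+Q≡u u+d≡v l+Q′≡v d<Q′ eu ev
    with ℕ.≤-total l k
  -- The order is l ≤ k ≤ u ≤ v. Adding the increments along the way makes Q (h v - h l) at least P
  -- Q′ - Q + 2, while `ev` allows at most P′ Q - Q = P Q′ - Q + 1.
  ... | inj₁ l≤k = 0≰-1
    (0≤+ (0≤+ (0≤+ (lower′ F d u+d≡v) (lower′ F f (ℕ.m+[n∸m]≡n l≤k))) (0≤* Q eu)) (0≤* Q ev))
    (trans (cong (λ x → + Q * (h v - h u + 1ℤ) - P * + d - 1ℤ + (+ Q * (h k - h l + 1ℤ) - P * x - 1ℤ)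
        + + Q * (h u - h k - P - 1ℤ) + + Q * (P′ - (h v - h l) - 1ℤ)) f≡)
      (trans (eq P (+ Q) P′ (+ Q′) (h u) (h v) (h k) (h l) (+ d)) (cong (_- (1ℤ + 1ℤ)) (F .det))))
    where
    f = k ℕ.∸ l
    f≡ : + f ≡ + Q′ - + Q - + d
    f≡ = trans (eqf (+ l) (+ f) (+ Q) (+ d)) (trans (cong (λ x → + x - + l - + Q - + d) l+f+Q+d)
      (eqf′ (+ l) (+ Q) (+ d) (+ Q′)))
      where
      eqf′ : ∀ l Q d Q′ → l + Q′ - l - Q - d ≡ Q′ - Q - d
      eqf′ = solve-∀
      eqf : ∀ l f Q d → f ≡ l + f + Q + d - l - Q - d
      eqf = solve-∀
      l+f+Q+d : l ℕ.+ f ℕ.+ Q ℕ.+ d ≡ l ℕ.+ Q′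
      l+f+Q+d = trans (cong (λ x → x ℕ.+ Q ℕ.+ d) (ℕ.m+[n∸m]≡n l≤k))
        (trans (cong (ℕ._+ d) k+Q≡u) (trans u+d≡v (sym l+Q′≡v)))
    eq : ∀ P Q P′ Q′ u v k l d →
      Q * (v - u + 1ℤ) - P * d - 1ℤ + (Q * (k - l + 1ℤ) - P * (Q′ - Q - d) - 1ℤ)
        + Q * (u - k - P - 1ℤ) + Q * (P′ - (v - l) - 1ℤ) ≡ P′ * Q - P * Q′ - (1ℤ + 1ℤ)
    eq = solve-∀
  -- Now h v - h k is estimated from below through u and from above through l. Together the
  -- estimates give Q + d ≥ Q + Q′, against d < Q′.
  ... | inj₂ k≤l = 0≰-1
    (0≤+ (0≤+ (0≤+ (0≤+ (0≤* Q (upper′ F f (ℕ.m+[n∸m]≡n k≤l))) (0≤* Q (0≤* Q′ eu)))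
      (0≤* Q (0≤* Q′ ev))) (0≤* Q′ (lower′ F d u+d≡v))) (<⇒0≤ d<Q′))
    (trans (cong (λ x → + Q * (P′ * x - + Q′ * (h l - h k - 1ℤ) - 1ℤ) + + Q * (+ Q′ * (h u - h k - P - 1ℤ))
        + + Q * (+ Q′ * (P′ - (h v - h l) - 1ℤ)) + + Q′ * (+ Q * (h v - h u + 1ℤ) - P * + d - 1ℤ)
        + (+ Q′ - + d - 1ℤ)) f≡)
      (trans (eq P (+ Q) P′ (+ Q′) (h u) (h v) (h k) (h l) (+ d))
        (trans (cong (λ D → + Q * (D - 1ℤ) + + d * D - + d - 1ℤ) (F .det)) (eq′ (+ Q) (+ d)))))
    where
    f = l ℕ.∸ k
    f≡ : + f ≡ + Q + + d - + Q′
    f≡ = trans (eqf (+ k) (+ f) (+ Q′)) (trans (cong (λ x → + x - + k - + Q′) k+f+Q′)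
      (eqf′ (+ k) (+ Q) (+ d) (+ Q′)))
      where
      eqf : ∀ k f Q → f ≡ k + f + Q - k - Q
      eqf = solve-∀
      eqf′ : ∀ k Q d Q′ → k + Q + d - k - Q′ ≡ Q + d - Q′
      eqf′ = solve-∀
      k+f+Q′ : k ℕ.+ f ℕ.+ Q′ ≡ k ℕ.+ Q ℕ.+ d
      k+f+Q′ = trans (cong (ℕ._+ Q′) (ℕ.m+[n∸m]≡n k≤l))
        (trans l+Q′≡v (trans (sym u+d≡v) (cong (ℕ._+ d) (sym k+Q≡u))))
    eq : ∀ P Q P′ Q′ u v k l d →
      Q * (P′ * (Q + d - Q′) - Q′ * (l - k - 1ℤ) - 1ℤ) + Q * (Q′ * (u - k - P - 1ℤ))
        + Q * (Q′ * (P′ - (v - l) - 1ℤ)) + Q′ * (Q * (v - u + 1ℤ) - P * d - 1ℤ) + (Q′ - d - 1ℤ)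
      ≡ Q * (P′ * Q - P * Q′ - 1ℤ) + d * (P′ * Q - P * Q′) - d - 1ℤ
    eq = solve-∀
    eq′ : ∀ Q d → Q * (1ℤ - 1ℤ) + d * 1ℤ - d - 1ℤ ≡ - 1ℤ
    eq′ = solve-∀

  exceptions-apart : Farey h P Q P′ Q′ → ∀ {u v n} k l → k ℕ.+ Q ≡ u → l ℕ.+ Q′ ≡ v →
    u ℕ.≤ v ℕ.+ n → v ℕ.≤ u ℕ.+ n → n ℕ.< Q → n ℕ.< Q′ →
    0ℤ ≤ h u - h k - P - 1ℤ → 0ℤ ≤ P′ - (h v - h l) - 1ℤ → ⊥
  exceptions-apart {h} {P} {Q} {P′} {Q′} F {u} {v} k l k+Q≡u l+Q′≡v u≤v+n v≤u+n n<Q n<Q′ eu ev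
    with ℕ.≤-total u v
  ... | inj₁ u≤v = exceptions-apart′ F k l (v ℕ.∸ u) k+Q≡u (ℕ.m+[n∸m]≡n u≤v) l+Q′≡v
    (ℕ.≤-<-trans (ℕ.m≤n+o⇒m∸n≤o v u v≤u+n) n<Q′) eu ev
  -- Negating `h` exchanges the two kinds of exception, hence the roles of u and v.
  ... | inj₂ v≤u = exceptions-apart′ (flip F) l k (u ℕ.∸ v) l+Q′≡v (ℕ.m+[n∸m]≡n v≤u) k+Q≡u
    (ℕ.≤-<-trans (ℕ.m≤n+o⇒m∸n≤o u v u≤v+n) n<Q)
    (subst (0ℤ ≤_) (eq₁ P′ (h v) (h l)) ev) (subst (0ℤ ≤_) (eq₂ P (h u) (h k)) eu)
    where
    eq₁ : ∀ P v l → P - (v - l) - 1ℤ ≡ - v - - l - - P - 1ℤ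
    eq₁ = solve-∀
    eq₂ : ∀ P u k → u - k - P - 1ℤ ≡ - P - (- u - - k) - 1ℤ
    eq₂ = solve-∀

  sum-below : (ℕ → ℤ) → ℕ → ℤ
  sum-below g zero    = 0ℤ
  sum-below g (suc n) = sum-below g n + g n

  sum-below-+ : ∀ g m n → sum-below g (m ℕ.+ n) ≡ sum-below g m + sum-below (g ∘ (m ℕ.+_)) n
  sum-below-+ g m zero    = trans (cong (sum-below g) (ℕ.+-identityʳ m)) (sym (ℤ.+-identityʳ _))
  sum-below-+ g m (suc n) = trans (cong (sum-below g) (ℕ.+-suc m n))
    (trans (cong (_+ g (m ℕ.+ n)) (sum-below-+ g m n)) (ℤ.+-assoc (sum-below g m) _ _))

  sum-increments : ℕ → ℕ → (ℕ → ℤ) → ℤ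
  sum-increments n d g = sum-below (g ∘ (d ℕ.+_)) n - sum-below g n

  -- Both sides are the sum of the first m + n terms minus the sums of the first m and of the first
  -- n terms.
  sum-increments-comm : ∀ m n g → sum-increments m n g ≡ sum-increments n m g
  sum-increments-comm m n g = trans (eq₁ (sum-below g n) _ _)
    (trans (cong (λ x → x - sum-below g n - sum-below g m)
      (trans (sym (sum-below-+ g n m)) (trans (cong (sum-below g) (ℕ.+-comm n m)) (sum-below-+ g m n))))
    (eq₂ (sum-below g m) _ (sum-below g n)))
    where
    eq₁ : ∀ x y z → y - z ≡ x + y - x - z
    eq₁ = solve-∀
    eq₂ : ∀ z y x → z + y - x - z ≡ y - x
    eq₂ = solve-∀

  sum-increments-mono : ∀ g {d c} n → (∀ {i} → i ℕ.< n → 0ℤ ≤ g (d ℕ.+ i) - g i - c) →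
    0ℤ ≤ sum-increments n d g - + n * c
  sum-increments-mono g zero    _ = 0≤n 0
  sum-increments-mono g {d} {c} (suc n) p = subst (0ℤ ≤_)
    (eq (sum-below (g ∘ (d ℕ.+_)) n) (sum-below g n) c (+ n) (g (d ℕ.+ n)) (g n))
    (0≤+ (sum-increments-mono g n (p ∘ ℕ.m<n⇒m<1+n)) (p ℕ.≤-refl))
    where
    eq : ∀ x y c n u v → x - y - n * c + (u - v - c) ≡ x + u - (y + v) - (1ℤ + n) * c
    eq = solve-∀

  sum-increments-const : ∀ g {d c} n → (∀ {i} → i ℕ.< n → g (d ℕ.+ i) - g i ≡ c) →
    sum-increments n d g ≡ + n * c
  sum-increments-const g zero    _ = refl
  sum-increments-const g {d} {c} (suc n) p = trans
    (eq₁ (sum-below (g ∘ (d ℕ.+_)) n) (sum-below g n) (g (d ℕ.+ n)) (g n))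
    (trans (cong₂ _+_ (sum-increments-const g n (p ∘ ℕ.m<n⇒m<1+n)) (p ℕ.≤-refl)) (eq₂ (+ n) c))
    where
    eq₁ : ∀ x y u v → x + u - (y + v) ≡ x - y + (u - v)
    eq₁ = solve-∀
    eq₂ : ∀ n c → n * c + c ≡ (1ℤ + n) * c
    eq₂ = solve-∀

  -- Double counting: Q increments over p steps, each Π, have the same sum as p increments over Q
  -- steps, each at least P.
  period-slope≥ : Farey h P Q P′ Q′ → ∀ p {Π} → (∀ {i} → i ℕ.< Q → h (p ℕ.+ i) - h i ≡ Π) →
    0ℤ ≤ + Q * Π - + p * P
  period-slope≥ {h} {P} {Q} F p periodic = subst (λ x → 0ℤ ≤ x - + p * P)
    (trans (sum-increments-comm p Q h) (sum-increments-const h Q periodic))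
    (sum-increments-mono h {Q} {P} p
      (λ {i} _ → subst (λ j → 0ℤ ≤ h j - h i - P) (ℕ.+-comm i Q) (increment≥ F i)))

  0<nonneg-combination : ∀ {p Q Q′} y x → 0ℤ ≤ y → 0ℤ ≤ x → + p ≡ + Q * y + + Q′ * x →
    0 ℕ.< p → Q ℕ.≤ p ⊎ Q′ ℕ.≤ p
  0<nonneg-combination {p} {Q} {Q′} (+ y) (+ x) _ _ p≡ 0<p = go y x (ℤ.+-injective
    (trans p≡ (cong₂ _+_ (sym (ℤ.pos-* Q y)) (sym (ℤ.pos-* Q′ x)))))
    where
    go : ∀ y x → p ≡ Q ℕ.* y ℕ.+ Q′ ℕ.* x → Q ℕ.≤ p ⊎ Q′ ℕ.≤ p
    go (suc y) x refl = inj₁ (ℕ.≤-trans (ℕ.m≤m*n Q (suc y)) (ℕ.m≤m+n _ _))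
    go zero (suc x) refl = inj₂ (ℕ.≤-trans (ℕ.m≤m*n Q′ (suc x)) (ℕ.m≤n+m _ _))
    go zero zero eq = ⊥-elim (ℕ.<⇒≢ 0<p (sym (trans eq (cong₂ ℕ._+_ (ℕ.*-zeroʳ Q) (ℕ.*-zeroʳ Q′)))))

  -- If p is a period with increment Π, then p = Q (p P′ - Q′ Π) + Q′ (Q Π - p P)
  -- and both coefficients are nonnegative, so p is at least Q or Q′.
  short-period-breaks : Farey h P Q P′ Q′ → ∀ {p Π} → 0 ℕ.< p → p ℕ.< Q → p ℕ.< Q′ →
    (∀ {i} → i ℕ.< Q ⊎ i ℕ.< Q′ → h (p ℕ.+ i) - h i ≡ Π) → ⊥
  short-period-breaks {h} {P} {Q} {P′} {Q′} F {p} {Π} 0<p p<Q p<Q′ periodic =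
    [ ℕ.<⇒≱ p<Q , ℕ.<⇒≱ p<Q′ ]′ (0<nonneg-combination
      (+ Q′ * - Π - + p * - P′) (+ Q * Π - + p * P)
      (period-slope≥ (flip F) p
        (λ {i} i<Q′ → trans (eq₁ (h (p ℕ.+ i)) (h i)) (cong -_ (periodic (inj₂ i<Q′)))))
      (period-slope≥ F p (periodic ∘ inj₁))
      (trans (sym (ℤ.*-identityʳ (+ p)))
        (trans (cong (+ p *_) (sym (F .det))) (eq₂ P (+ Q) P′ (+ Q′) (+ p) Π)))
      0<p)
    where
    eq₁ : ∀ x y → - x - - y ≡ - (x - y)
    eq₁ = solve-∀
    eq₂ : ∀ P Q P′ Q′ p Π → p * (P′ * Q - P * Q′) ≡ Q * (Q′ * - Π - p * - P′) + Q′ * (Q * Π - p * P)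
    eq₂ = solve-∀

-- Rational arithmetic and the embedding of the integers

module ℚ-Arithmetic where
  open import Data.Rational using (_+_; _-_; _*_; -_; _≤_; _<_; _/_)
  open ℚ-Solver.+-*-Solver
  open import Defs using (recip)

  -- Reduces an inequality to a known one and a ring identity. Later proofs add up all inequalities
  -- at hand and conclude with a single use.
  ≤-by : ∀ {p q r s} → q - p ≡ s - r → p ≤ q → r ≤ s
  ≤-by {p} {q} {r} {s} eq p≤q = subst₂ _≤_
    (solve 2 (λ p r → p :+ (r :- p) := r) refl p r)
    (trans (solve 3 (λ p q r → q :+ (r :- p) := (q :- p) :+ r) refl p q r)
      (trans (cong (_+ r) eq) (solve 2 (λ r s → (s :- r) :+ r := s) refl r s)))
    (ℚ.+-monoˡ-≤ (r - p) p≤q)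

  <⇒≱ : ∀ {p q} → p < q → ¬ (q ≤ p)
  <⇒≱ p<q q≤p = ℚ.<-irrefl refl (ℚ.<-≤-trans p<q q≤p)

  p≤∣p∣ : ∀ p → p ≤ ∣ p ∣
  p≤∣p∣ p with ℚ.≤-total 0ℚ p
  ... | inj₁ 0≤p = ℚ.≤-reflexive (sym (ℚ.0≤p⇒∣p∣≡p 0≤p))
  ... | inj₂ p≤0 = ℚ.≤-trans p≤0 (ℚ.0≤∣p∣ p)

  p+ε≰p : ∀ {p ε} → 0ℚ < ε → ¬ (p + ε ≤ p)
  p+ε≰p {p} {ε} 0<ε p+ε≤p = <⇒≱ 0<ε
    (≤-by (solve 2 (λ p ε → p :- (p :+ ε) := con 0ℚ :- ε) refl p ε) p+ε≤p)

  ι : ℤ → ℚ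
  ι k = k / 1

  private
    -- `k / 1` is normalised by a gcd, which is stuck for a variable k; this form is already
    -- reduced, so arithmetic on it computes.
    ι′ : ℤ → ℚ
    ι′ k = mkℚ k 0 (Coprimality.sym (Coprimality.1-coprimeTo ℤ.∣ k ∣))

    ι≡ : ∀ k → ι k ≡ ι′ k
    ι≡ k = ℚ.↥p/↧p≡p (ι′ k)

  ι-+ : ∀ k l → ι (k ℤ.+ l) ≡ ι k + ι l
  ι-+ k l = sym (trans (cong₂ _+_ (ι≡ k) (ι≡ l))
    (cong ι (cong₂ ℤ._+_ (ℤ.*-identityʳ k) (ℤ.*-identityʳ l))))

  ι-* : ∀ k l → ι (k ℤ.* l) ≡ ι k * ι l
  ι-* k l = sym (cong₂ _*_ (ι≡ k) (ι≡ l))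

  ι-neg : ∀ k → ι (ℤ.- k) ≡ - ι k
  ι-neg k = trans (ι≡ (ℤ.- k)) (sym (trans (cong -_ (ι≡ k)) (neg k)))
    where
    neg : ∀ k → - ι′ k ≡ ι′ (ℤ.- k)
    neg (+ zero)  = refl
    neg (+ suc n) = refl
    neg -[1+ n ]  = refl

  ι-- : ∀ k l → ι (k ℤ.- l) ≡ ι k - ι l
  ι-- k l = trans (ι-+ k (ℤ.- l)) (cong (λ p → ι k + p) (ι-neg l))

  ι-mono : ∀ {k l} → k ℤ.≤ l → ι k ≤ ι l
  ι-mono {k} {l} k≤l = subst₂ _≤_ (sym (ι≡ k)) (sym (ι≡ l))
    (*≤* (subst₂ ℤ._≤_ (sym (ℤ.*-identityʳ k)) (sym (ℤ.*-identityʳ l)) k≤l))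

  ι-cancel : ∀ {k l} → ι k ≤ ι l → k ℤ.≤ l
  ι-cancel {k} {l} p with subst₂ _≤_ (ι≡ k) (ι≡ l) p
  ... | *≤* q = subst₂ ℤ._≤_ (ℤ.*-identityʳ k) (ℤ.*-identityʳ l) q

  *-cancelʳ-≤ : ∀ {p q r} → 0ℚ < r → p * r ≤ q * r → p ≤ q
  *-cancelʳ-≤ {r = r} 0<r = ℚ.*-cancelʳ-≤-pos r {{ℚ.positive 0<r}}

  recip-inverse : ∀ {p} → 0ℚ < p → recip p * p ≡ 1ℚ
  recip-inverse {p} 0<p with p ℚ.≟ 0ℚ
  ... | yes refl = contradiction 0<p (ℚ.<-irrefl refl)
  ... | no  p≢0  = ℚ.*-inverseˡ p {{ℚ.≢-nonZero p≢0}}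

  0<recip : ∀ {p} → 0ℚ < p → 0ℚ < recip p
  0<recip {p} 0<p with p ℚ.≟ 0ℚ
  ... | yes refl = contradiction 0<p (ℚ.<-irrefl refl)
  ... | no  p≢0  = ℚ.positive⁻¹ _ {{ℚ.1/pos⇒pos p {{ℚ.positive 0<p}}}}

open FareyPairs
open ℚ-Arithmetic
open import Defs

-- Words and counting

unique-⊆⇒length≤ : {A : Set} {xs ys : List A} → Unique xs → xs ⊆ ys → length xs ℕ.≤ length ys
unique-⊆⇒length≤ {xs = []} [] _ = z≤n
unique-⊆⇒length≤ {xs = x ∷ xs} (x∉xs ∷ uniq) xs⊆ys with ∈-∃++ (xs⊆ys (here refl))
... | us , vs , refl = subst (suc (length xs) ℕ.≤_)
  (trans (cong suc (List.length-++ us)) (trans (sym (ℕ.+-suc (length us) (length vs))) (sym (List.length-++ us))))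
  (s≤s (unique-⊆⇒length≤ uniq λ y∈xs → drop-x (All.lookup x∉xs y∈xs) (xs⊆ys (there y∈xs))))
  where
  drop-x : ∀ {y} → x ≢ y → y ∈ us ++ x ∷ vs → y ∈ us ++ vs
  drop-x x≢y y∈ with ∈-++⁻ us y∈
  ... | inj₁ y∈us          = ∈-++⁺ˡ y∈us
  ... | inj₂ (here y≡x)    = contradiction (sym y≡x) x≢y
  ... | inj₂ (there y∈vs)  = ∈-++⁺ʳ us y∈vs

module _ {A : Set} {P T : A → Set} (P? : Decidable P) (T? : Decidable T) where
  length-filter-∪ : ∀ xs →
    length (filter (P? ∪? T?) xs) ℕ.≤ length (filter P? xs) ℕ.+ length (filter T? xs)
  length-filter-∪ [] = z≤n
  length-filter-∪ (x ∷ xs) with P? x | T? x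
  ... | yes _ | yes _ = s≤s (ℕ.≤-trans (length-filter-∪ xs) (ℕ.+-monoʳ-≤ _ (ℕ.n≤1+n _)))
  ... | yes _ | no  _ = s≤s (length-filter-∪ xs)
  ... | no  _ | yes _ = subst (suc (length (filter (P? ∪? T?) xs)) ℕ.≤_)
    (sym (ℕ.+-suc (length (filter P? xs)) _)) (s≤s (length-filter-∪ xs))
  ... | no  _ | no  _ = length-filter-∪ xs

  length≤filter+filter : (∀ x → P x ⊎ T x) → ∀ xs →
    length xs ℕ.≤ length (filter P? xs) ℕ.+ length (filter T? xs)
  length≤filter+filter cover xs = subst (λ ys → length ys ℕ.≤ length (filter P? xs) ℕ.+ length (filter T? xs))
    (List.filter-all (P? ∪? T?) (All.universal cover xs)) (length-filter-∪ xs)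

Σ< : ℕ → (ℕ → ℕ) → ℕ
Σ< zero    f = 0
Σ< (suc n) f = Σ< n f ℕ.+ f n

sum-map-upTo : ∀ f n → ListAction.sum (map f (upTo n)) ≡ Σ< n f
sum-map-upTo f zero    = refl
sum-map-upTo f (suc n) = begin
  ListAction.sum (map f (upTo (suc n)))          ≡⟨ cong (ListAction.sum ∘ map f) (List.upTo-∷ʳ n) ⟨
  ListAction.sum (map f (upTo n ++ [ n ]))       ≡⟨ cong ListAction.sum (List.map-++ f (upTo n) [ n ]) ⟩
  ListAction.sum (map f (upTo n) ++ [ f n ])     ≡⟨ sum-++ (map f (upTo n)) [ f n ] ⟩
  ListAction.sum (map f (upTo n)) ℕ.+ (f n ℕ.+ 0) ≡⟨ cong₂ ℕ._+_ (sum-map-upTo f n) (ℕ.+-identityʳ (f n)) ⟩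
  Σ< n f ℕ.+ f n                      ∎
  where open ≡-Reasoning

Σ<-monoˡ : ∀ f {m n} → m ℕ.≤ n → Σ< m f ℕ.≤ Σ< n f
Σ<-monoˡ f {m} {zero}  z≤n = z≤n
Σ<-monoˡ f {m} {suc n} m≤1+n with ℕ.m≤n⇒m<n∨m≡n m≤1+n
... | inj₁ (s≤s m≤n) = ℕ.≤-trans (Σ<-monoˡ f m≤n) (ℕ.m≤m+n _ _)
... | inj₂ refl      = ℕ.≤-refl

double : ℕ → ℕ
double n = n ℕ.+ n

-- The numbers 2i with i < n are distinct indices of the larger sum.
Σ<-double : ∀ f n → Σ< n (f ∘ double) ℕ.≤ Σ< (double n) f
Σ<-double f zero    = z≤n
Σ<-double f (suc n) = subst (λ k → Σ< (suc n) (f ∘ double) ℕ.≤ Σ< k f) (cong suc (sym (ℕ.+-suc n n)))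
  (ℕ.≤-trans (ℕ.+-monoˡ-≤ (f (double n)) (Σ<-double f n)) (ℕ.m≤m+n _ _))

Σ<-+-≥ : ∀ f m n {c} → (∀ i → m ℕ.≤ i → c ℕ.≤ f i) → n ℕ.* c ℕ.≤ Σ< (m ℕ.+ n) f
Σ<-+-≥ f m zero    _ = z≤n
Σ<-+-≥ f m (suc n) {c} c≤f = begin
  c ℕ.+ n ℕ.* c                       ≡⟨ ℕ.+-comm c _ ⟩
  n ℕ.* c ℕ.+ c                       ≤⟨ ℕ.+-mono-≤ (Σ<-+-≥ f m n c≤f) (c≤f (m ℕ.+ n) (ℕ.m≤m+n m n)) ⟩
  Σ< (suc (m ℕ.+ n)) f                ≡⟨ cong (λ k → Σ< k f) (ℕ.+-suc m n) ⟨
  Σ< (m ℕ.+ suc n) f                  ∎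
  where open ℕ.≤-Reasoning

Σ<-linear : ∀ f g c n → Σ< n (λ i → c ℕ.* f i ℕ.+ g i) ≡ c ℕ.* Σ< n f ℕ.+ Σ< n g
Σ<-linear f g c zero    = sym (trans (ℕ.+-identityʳ _) (ℕ.*-zeroʳ c))
Σ<-linear f g c (suc n) = trans (cong (ℕ._+ (c ℕ.* f n ℕ.+ g n)) (Σ<-linear f g c n))
  (solve 5 (λ c x y u v → c :* x :+ y :+ (c :* u :+ v) := c :* (x :+ u) :+ (y :+ v)) refl
    c (Σ< n f) (Σ< n g) (f n) (g n))
  where open +-*-Solver

countA : (ℕ → Letter) → ℕ → ℕ
countA g zero    = 0
countA g (suc n) = occurrences a [ g 0 ] ℕ.+ countA (g ∘ suc) n

countA-cong : ∀ {f g} → (∀ i → f i ≡ g i) → ∀ n → countA f n ≡ countA g n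
countA-cong f≗g zero    = refl
countA-cong f≗g (suc n) =
  cong₂ ℕ._+_ (cong (occurrences a ∘ [_]) (f≗g 0)) (countA-cong (f≗g ∘ suc) n)

countA-+ : ∀ g m n → countA g (m ℕ.+ n) ≡ countA g m ℕ.+ countA (g ∘ (m ℕ.+_)) n
countA-+ g zero    n = refl
countA-+ g (suc m) n =
  trans (cong (occurrences a [ g 0 ] ℕ.+_) (countA-+ (g ∘ suc) m n)) (sym (ℕ.+-assoc (occurrences a [ g 0 ]) _ _))

occurrences-a : ∀ g n → occurrences a (applyUpTo g n) ≡ countA g n
occurrences-a g zero = refl
occurrences-a g (suc n) with g 0
... | a = cong suc (occurrences-a (g ∘ suc) n)
... | b = occurrences-a (g ∘ suc) n

occurrences-a+b : ∀ w → occurrences a w ℕ.+ occurrences b w ≡ length w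
occurrences-a+b []      = refl
occurrences-a+b (a ∷ w) = cong suc (occurrences-a+b w)
occurrences-a+b (b ∷ w) = trans (ℕ.+-suc (occurrences a w) _) (cong suc (occurrences-a+b w))

same-occurrences : ∀ {v w} → length v ≡ length w → occurrences a v ≡ occurrences a w →
  ∀ c → occurrences c v ≡ occurrences c w
same-occurrences _ eq a = eq
same-occurrences {v} {w} len eq b = ℕ.+-cancelˡ-≡ (occurrences a v) _ _
  (trans (occurrences-a+b v) (trans len
    (trans (sym (occurrences-a+b w)) (cong (ℕ._+ occurrences b w) (sym eq)))))

applyUpTo≡⇒countA≡ : ∀ {f g} m → applyUpTo f m ≡ applyUpTo g m → ∀ {t} → t ℕ.≤ m → countA f t ≡ countA g t
applyUpTo≡⇒countA≡ m       eq z≤n       = refl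
applyUpTo≡⇒countA≡ (suc m) eq (s≤s t≤m) = cong₂ ℕ._+_ (cong (occurrences a ∘ [_]) (List.∷-injectiveˡ eq))
  (applyUpTo≡⇒countA≡ m (List.∷-injectiveʳ eq) t≤m)

-- Each letter is the difference of two consecutive prefix counts, so words can be compared through
-- heights alone.
countA≡⇒applyUpTo≡ : ∀ {f g} m → (∀ {t} → t ℕ.≤ m → countA f t ≡ countA g t) → applyUpTo f m ≡ applyUpTo g m
countA≡⇒applyUpTo≡ zero _ = refl
countA≡⇒applyUpTo≡ {f} {g} (suc m) eq = cong₂ _∷_ head≡
  (countA≡⇒applyUpTo≡ m λ t≤m → ℕ.+-cancelˡ-≡ (occurrences a [ f 0 ]) _ _
    (trans (eq (s≤s t≤m)) (cong (λ x → occurrences a [ x ] ℕ.+ _) (sym head≡))))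
  where
  occurrences-injective : ∀ x y → occurrences a [ x ] ≡ occurrences a [ y ] → x ≡ y
  occurrences-injective a a _ = refl
  occurrences-injective b b _ = refl
  head≡ : f 0 ≡ g 0
  head≡ = occurrences-injective _ _ (ℕ.+-cancelʳ-≡ 0 _ _ (eq (s≤s z≤n)))

applyUpTo-+ : ∀ {A : Set} (f : ℕ → A) m n → applyUpTo f (m ℕ.+ n) ≡ applyUpTo f m ++ applyUpTo (f ∘ (m ℕ.+_)) n
applyUpTo-+ f zero    n = refl
applyUpTo-+ f (suc m) n = cong (f 0 ∷_) (applyUpTo-+ (f ∘ suc) m n)

_≟ʷ_ : (v w : List Letter) → Dec (v ≡ w)
_≟ʷ_ = List.≡-dec _≟_

-- The search over pairs of words reduces to a bounded search for the position of the cut.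
abelianSquare? : Decidable AbelianSquare
abelianSquare? w = Dec.map′ to from (ℕ.anyUpTo? balanced? (suc (length w)))
  where
  Balanced : ℕ → Set
  Balanced k = occurrences a (take k w) ≡ occurrences a (drop k w) × occurrences b (take k w) ≡ occurrences b (drop k w)
  balanced? : Decidable Balanced
  balanced? k = (_ ℕ.≟ _) ×-dec (_ ℕ.≟ _)
  to : (∃ λ k → k ℕ.< suc (length w) × Balanced k) → AbelianSquare w
  to (k , _ , eqa , eqb) = take k w , drop k w , sym (List.take++drop≡id k w) , λ { a → eqa ; b → eqb }
  from : AbelianSquare w → ∃ λ k → k ℕ.< suc (length w) × Balanced k
  from (u , v , refl , eq) = length u , s≤s (subst (length u ℕ.≤_) (sym (List.length-++ u)) (ℕ.m≤m+n _ _)) ,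
    subst₂ Same (sym (take-length u)) (sym (drop-length u)) (eq a , eq b)
    where
    Same : List Letter → List Letter → Set
    Same x y = occurrences a x ≡ occurrences a y × occurrences b x ≡ occurrences b y
    take-length : ∀ u → take (length u) (u ++ v) ≡ u
    take-length []      = refl
    take-length (x ∷ u) = cong (x ∷_) (take-length u)
    drop-length : ∀ u → drop (length u) (u ++ v) ≡ v
    drop-length []      = refl
    drop-length (x ∷ u) = drop-length u

-- Factors of a word whose heights have Farey neighbours at every scale

height : InfiniteWord → ℕ → ℤ
height s n = + countA s n

factor : InfiniteWord → ℕ → ℕ → List Letter
factor s m i = applyUpTo (s ∘ (i ℕ.+_)) m

height-increment : ∀ s i j → height s (i ℕ.+ j) ℤ.- height s i ≡ + countA (s ∘ (i ℕ.+_)) j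
height-increment s i j = trans (cong (λ n → + n ℤ.- height s i) (countA-+ s i j))
  (eq (height s i) (+ countA (s ∘ (i ℕ.+_)) j))
  where
  eq : ∀ x y → x ℤ.+ y ℤ.- x ≡ y
  eq = solve-∀

WithinLinear : (ℕ → ℕ → Set) → ℕ → Set
WithinLinear R K = ∀ n → 1 ℕ.≤ n → ∃[ Q ] ∃[ Q′ ]
  n ℕ.≤ Q × n ℕ.≤ Q′ × Q ℕ.≤ K ℕ.* n × Q′ ℕ.≤ K ℕ.* n × R Q Q′

module _ (s : InfiniteWord) (K : ℕ) .{{_ : ℕ.NonZero K}}
  (farey : WithinLinear (λ Q Q′ → ∃[ P ] ∃[ P′ ] Farey (height s) P Q P′ Q′) K) where

  private
    h = height s

  same-increments⇒same-factor : ∀ m i k {P} →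
    (∀ {t} → t ℕ.≤ m → h (i ℕ.+ t) ℤ.- h (k ℕ.+ t) ≡ P) → factor s m i ≡ factor s m k
  same-increments⇒same-factor m i k {P} eq = countA≡⇒applyUpTo≡ m λ {t} t≤m → ℤ.+-injective
    (trans (sym (height-increment s i t)) (trans
      (eq′ (h (i ℕ.+ t)) (h i) (h (k ℕ.+ t)) (h k) (trans (eq t≤m) (trans (sym (eq z≤n))
        (cong₂ (λ x y → h x ℤ.- h y) (ℕ.+-identityʳ i) (ℕ.+-identityʳ k)))))
      (height-increment s k t)))
    where
    eq′ : ∀ x y u v → x ℤ.- u ≡ y ℤ.- v → x ℤ.- y ≡ u ℤ.- v
    eq′ x y u v p = trans (e₁ x y u) (trans (cong (ℤ._+ (u ℤ.- y)) p) (e₂ y u v))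
      where
      e₁ : ∀ x y u → x ℤ.- y ≡ x ℤ.- u ℤ.+ (u ℤ.- y)
      e₁ = solve-∀
      e₂ : ∀ y u v → y ℤ.- v ℤ.+ (u ℤ.- y) ≡ u ℤ.- v
      e₂ = solve-∀

  -- If the increments over Q steps that start at k + t all equal P, the factor at k + Q repeats the
  -- one at k; similarly for Q′, P′ and l. Failure of both would produce exceptions of both kinds at
  -- distance at most m.
  recurs : ∀ {P Q P′ Q′} → Farey h P Q P′ Q′ → ∀ {m} k l → m ℕ.< Q → m ℕ.< Q′ → k ℕ.+ Q ≡ l ℕ.+ Q′ →
    factor s m (k ℕ.+ Q) ≡ factor s m k ⊎ factor s m (k ℕ.+ Q) ≡ factor s m l
  recurs {P} {Q} {P′} {Q′} F {m} k l m<Q m<Q′ k+Q≡l+Q′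
    with factor s m (k ℕ.+ Q) ≟ʷ factor s m k | factor s m (k ℕ.+ Q) ≟ʷ factor s m l
  ... | yes eq | _      = inj₁ eq
  ... | _      | yes eq = inj₂ eq
  -- Word equality is decidable, so both failures may be assumed. Each refuted equality is then
  -- attempted position by position, which brings up the exceptional t and, inside, t′.
  ... | no ne  | no ne′ = ⊥-elim (ne (same-increments⇒same-factor m i k λ {t} t≤m →
    [ ℤ.i-j≡0⇒i≡j _ _ , (λ e → ⊥-elim (ne′ (same-increments⇒same-factor m i l λ {t′} t′≤m →
        [ sym ∘ ℤ.i-j≡0⇒i≡j P′ _ ,
          (λ e′ → ⊥-elim (exceptions-apart F (k ℕ.+ t) (l ℕ.+ t′) (swap k t Q)
            (trans (swap l t′ Q′) (cong (ℕ._+ t′) (sym k+Q≡l+Q′)))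
            (close t≤m) (close t′≤m) m<Q m<Q′ e e′)) ]′
        (zero∨positive (excess′ t′))))) ]′
      (zero∨positive (excess t))))
    where
    i = k ℕ.+ Q
    swap : ∀ x y z → x ℕ.+ y ℕ.+ z ≡ x ℕ.+ z ℕ.+ y
    swap x y z = trans (ℕ.+-assoc x y z) (trans (cong (x ℕ.+_) (ℕ.+-comm y z)) (sym (ℕ.+-assoc x z y)))
    close : ∀ {t t′} → t ℕ.≤ m → i ℕ.+ t ℕ.≤ i ℕ.+ t′ ℕ.+ m
    close {t} {t′} t≤m = ℕ.+-mono-≤ (ℕ.m≤m+n i t′) t≤m
    excess : ∀ t → 0ℤ ℤ.≤ h (i ℕ.+ t) ℤ.- h (k ℕ.+ t) ℤ.- P
    excess t = subst (λ x → 0ℤ ℤ.≤ h x ℤ.- h (k ℕ.+ t) ℤ.- P) (swap k t Q) (increment≥ F (k ℕ.+ t))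
    excess′ : ∀ t → 0ℤ ℤ.≤ P′ ℤ.- (h (i ℕ.+ t) ℤ.- h (l ℕ.+ t))
    excess′ t = subst (λ x → 0ℤ ℤ.≤ P′ ℤ.- (h x ℤ.- h (l ℕ.+ t)))
      (trans (swap l t Q′) (cong (ℕ._+ t) (sym k+Q≡l+Q′)))
      (subst (0ℤ ℤ.≤_) (eq P′ (h (l ℕ.+ t ℕ.+ Q′)) (h (l ℕ.+ t))) (increment≥ (flip F) (l ℕ.+ t)))
      where
      eq : ∀ P x y → ℤ.- x ℤ.- ℤ.- y ℤ.- ℤ.- P ≡ P ℤ.- (x ℤ.- y)
      eq = solve-∀

  -- Steps back by Q or Q′ lead every occurrence below max(Q, Q′). A finite search therefore finds
  -- all factors of length m, as `IsASF` requires.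
  recurrence-bound : ∀ m → ∃[ R ] ∀ i → ∃[ k ] k ℕ.< R × factor s m i ≡ factor s m k
  recurrence-bound m with farey (suc m) (s≤s z≤n)
  ... | Q , Q′ , m<Q , m<Q′ , _ , _ , _ , _ , F = Q ℕ.⊔ Q′ , <-rec _ step
    where
    step : ∀ i → (∀ {i′} → i′ ℕ.< i → ∃[ k ] k ℕ.< Q ℕ.⊔ Q′ × factor s m i′ ≡ factor s m k) →
      ∃[ k ] k ℕ.< Q ℕ.⊔ Q′ × factor s m i ≡ factor s m k
    step i rec with i ℕ.<? Q ℕ.⊔ Q′
    ... | yes i<R = i , i<R , refl
    ... | no  i≮R = [ back Q≤i m<Q , back Q′≤i m<Q′ ]′ (subst
      (λ j → factor s m j ≡ factor s m (i ℕ.∸ Q) ⊎ factor s m j ≡ factor s m (i ℕ.∸ Q′))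
      (ℕ.m∸n+n≡m Q≤i)
      (recurs F (i ℕ.∸ Q) (i ℕ.∸ Q′) m<Q m<Q′ (trans (ℕ.m∸n+n≡m Q≤i) (sym (ℕ.m∸n+n≡m Q′≤i)))))
      where
      Q≤i  = ℕ.m⊔n≤o⇒m≤o Q Q′ (ℕ.≮⇒≥ i≮R)
      Q′≤i = ℕ.m⊔n≤o⇒n≤o Q Q′ (ℕ.≮⇒≥ i≮R)
      back : ∀ {q} → q ℕ.≤ i → m ℕ.< q → factor s m i ≡ factor s m (i ℕ.∸ q) →
        ∃[ k ] k ℕ.< Q ℕ.⊔ Q′ × factor s m i ≡ factor s m k
      back {suc q} q≤i _ eq with rec (ℕ.∸-monoʳ-< {o = 0} (s≤s z≤n) q≤i)
      ... | k , k<R , eq′ = k , k<R , trans eq eq′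

  factors squares : ℕ → List (List Letter)
  factors m = map (factor s m) (upTo (proj₁ (recurrence-bound m)))
  squares m = filter abelianSquare? (deduplicate _≟ʷ_ (factors m))

  squares-unique : ∀ m → Unique (squares m)
  squares-unique m = Unique.filter⁺ abelianSquare? (DecUnique.deduplicate-! _≟ʷ_ (factors m))

  factor∈squares : ∀ m i → AbelianSquare (factor s m i) → factor s m i ∈ squares m
  factor∈squares m i sq with recurrence-bound m .proj₂ i
  ... | k , k<R , f≡ = ∈-filter⁺ abelianSquare? {xs = deduplicate _≟ʷ_ (factors m)}
    (∈-deduplicate⁺ _≟ʷ_ {xs = factors m}
      (subst (_∈ factors m) (sym f≡) (∈-map⁺ (factor s m) (∈-upTo⁺ k<R)))) sq

  ∈squares⇒ : ∀ m {w} → w ∈ squares m → length w ≡ m × w IsFactorOf s × AbelianSquare w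
  ∈squares⇒ m w∈ with ∈-filter⁻ abelianSquare? {xs = deduplicate _≟ʷ_ (factors m)} w∈
  ... | w∈′ , sq with ∈-map⁻ (factor s m) (∈-deduplicate⁻ _≟ʷ_ (factors m) w∈′)
  ... | i , _ , refl = len , (i , cong (λ n → factor s n i) (sym len)) , sq
    where len = List.length-applyUpTo (s ∘ (i ℕ.+_)) m

  asf : ℕ → ℕ
  asf m = length (squares m)

  asf-isASF : IsASF s asf
  asf-isASF m = squares m , squares-unique m , (λ w → mk⇔ (∈squares⇒ m) from) , refl
    where
    from : ∀ {w} → length w ≡ m × w IsFactorOf s × AbelianSquare w → w ∈ squares m
    from (refl , (i , eq) , sq) =
      subst (_∈ squares _) (sym eq) (factor∈squares _ i (subst AbelianSquare eq sq))

  -- The neighbours are taken just above p, not at the scale of ℓ: then Q and Q′ exceed p but are at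
  -- most K (p + 1) ≤ K L ≤ ℓ, so equal words make p a period for long enough to contradict
  -- `short-period-breaks`.
  factors-distinct′ : ∀ {L ℓ} → K ℕ.* L ℕ.≤ ℓ → ∀ i p → 0 ℕ.< p → p ℕ.< L →
    factor s ℓ i ≢ factor s ℓ (i ℕ.+ p)
  factors-distinct′ {L} {ℓ} KL≤ℓ i p 0<p p<L eq with farey (suc p) (s≤s z≤n)
  ... | Q , Q′ , p<Q , p<Q′ , Q≤Kp , Q′≤Kp , _ , _ , F = short-period-breaks (shift i F) 0<p p<Q p<Q′
    [ (λ t<Q → periodic (ℕ.<⇒≤ (ℕ.<-≤-trans t<Q (within Q≤Kp)))) ,
      (λ t<Q → periodic (ℕ.<⇒≤ (ℕ.<-≤-trans t<Q (within Q′≤Kp)))) ]′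
    where
    within : ∀ {q} → q ℕ.≤ K ℕ.* suc p → q ℕ.≤ ℓ
    within q≤ = ℕ.≤-trans q≤ (ℕ.≤-trans (ℕ.*-monoʳ-≤ K p<L) KL≤ℓ)
    rearrange : ∀ u v x y → v ℤ.- y ≡ u ℤ.- x → v ℤ.- u ≡ y ℤ.- x
    rearrange u v x y p = trans (e₁ u v y) (trans (cong (ℤ._+ (y ℤ.- u)) p) (e₂ u x y))
      where
      e₁ : ∀ u v y → v ℤ.- u ≡ v ℤ.- y ℤ.+ (y ℤ.- u)
      e₁ = solve-∀
      e₂ : ∀ u x y → u ℤ.- x ℤ.+ (y ℤ.- u) ≡ y ℤ.- x
      e₂ = solve-∀
    periodic : ∀ {t} → t ℕ.≤ ℓ → h (i ℕ.+ (p ℕ.+ t)) ℤ.- h (i ℕ.+ t) ≡ h (i ℕ.+ p) ℤ.- h i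
    periodic {t} t≤ℓ = trans (cong (λ x → h x ℤ.- h (i ℕ.+ t)) (sym (ℕ.+-assoc i p t)))
      (rearrange (h (i ℕ.+ t)) (h (i ℕ.+ p ℕ.+ t)) (h i) (h (i ℕ.+ p))
        (trans (height-increment s (i ℕ.+ p) t)
          (trans (cong +_ (sym (applyUpTo≡⇒countA≡ ℓ eq t≤ℓ))) (sym (height-increment s i t)))))

  factors-distinct : ∀ {L ℓ} → K ℕ.* L ℕ.≤ ℓ → ∀ k →
    Injective _≡_ _≡_ (λ (i : Fin L) → factor s ℓ (k ℕ.+ toℕ i))
  factors-distinct {L} {ℓ} KL≤ℓ k {i} {j} eq = by-order (ℕ.<-cmp (toℕ i) (toℕ j))
    where
    later : ∀ (i j : Fin L) → toℕ i ℕ.< toℕ j → factor s ℓ (k ℕ.+ toℕ i) ≢ factor s ℓ (k ℕ.+ toℕ j)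
    later i j i<j eq = factors-distinct′ KL≤ℓ (k ℕ.+ toℕ i) (toℕ j ℕ.∸ toℕ i) (ℕ.m<n⇒0<n∸m i<j)
      (ℕ.≤-<-trans (ℕ.m∸n≤m (toℕ j) (toℕ i)) (Fin.toℕ<n j))
      (trans eq (cong (factor s ℓ)
        (sym (trans (ℕ.+-assoc k _ _) (cong (k ℕ.+_) (ℕ.m+[n∸m]≡n (ℕ.<⇒≤ i<j)))))))
    by-order : Tri (toℕ i ℕ.< toℕ j) (toℕ i ≡ toℕ j) (toℕ j ℕ.< toℕ i) → i ≡ j
    by-order (tri< i<j _ _) = ⊥-elim (later i j i<j eq)
    by-order (tri≈ _ i≡j _) = Fin.toℕ-injective i≡j
    by-order (tri> _ _ j<i) = ⊥-elim (later j i j<i (sym eq))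

  -- Within a window of L positions the words are distinct, so positions of squares can be counted
  -- in place of squares.
  squares-in-window : ∀ {L ℓ} → K ℕ.* L ℕ.≤ ℓ → ∀ k →
    length (filter (λ i → abelianSquare? (factor s ℓ (k ℕ.+ toℕ i))) (allFin L)) ℕ.≤ asf ℓ
  squares-in-window {L} {ℓ} KL≤ℓ k = subst (ℕ._≤ asf ℓ) (List.length-map (word) window)
    (unique-⊆⇒length≤ (Unique.map⁺ (factors-distinct KL≤ℓ k) (Unique.filter⁺ sq? (Unique.allFin⁺ L)))
      ⊆squares)
    where
    word : Fin L → List Letter
    word i = factor s ℓ (k ℕ.+ toℕ i)
    sq? : ∀ i → Dec (AbelianSquare (word i))
    sq? = abelianSquare? ∘ word
    window = filter sq? (allFin L)
    ⊆squares : map word window ⊆ squares ℓ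
    ⊆squares w∈ with ∈-map⁻ word w∈
    ... | i , i∈ , refl = factor∈squares ℓ (k ℕ.+ toℕ i) (∈-filter⁻ sq? {xs = allFin L} i∈ .proj₂)

  block : ℕ → ℕ → ℕ
  block m i = countA (s ∘ (i ℕ.+_)) m

  block-+ : ∀ m n i → block (m ℕ.+ n) i ≡ block m i ℕ.+ block n (i ℕ.+ m)
  block-+ m n i = trans (countA-+ (s ∘ (i ℕ.+_)) m n)
    (cong (block m i ℕ.+_) (countA-cong (λ j → cong s (sym (ℕ.+-assoc i m j))) n))

  equal-blocks⇒square : ∀ m i → block m i ≡ block m (i ℕ.+ m) → AbelianSquare (factor s (double m) i)
  equal-blocks⇒square m i eq = applyUpTo f m , applyUpTo g m , applyUpTo-+ f m m ,
    same-occurrences {applyUpTo f m} {applyUpTo g m} (trans (List.length-applyUpTo f m) (sym (List.length-applyUpTo g m)))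
      (trans (occurrences-a f m) (trans eq (trans
        (countA-cong (λ j → cong s (ℕ.+-assoc i m j)) m) (sym (occurrences-a g m)))))
    where
    f = s ∘ (i ℕ.+_)
    g = f ∘ (m ℕ.+_)

  blocks-close : ∀ m i j → block m i ℕ.≤ suc (block m j)
  blocks-close m i j with farey (suc m) (s≤s z≤n)
  ... | Q , _ , m<Q , _ , _ , _ , _ , _ , F = ℤ.drop‿+≤+ (ℤ.0≤i-j⇒j≤i (subst (0ℤ ℤ.≤_)
    (cong₂ ℤ._-_ (trans (cong (ℤ._+ 1ℤ) (height-increment s j m)) (ℤ.+-comm (+ block m j) 1ℤ)) (height-increment s i m))
    (increments-close F j i m<Q)))

  -- A binary word of length four contains a square, so four consecutive blocks
  -- whose counts take at most two adjacent values contain an abelian square.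
  square-nearby : ∀ m i → AbelianSquare (factor s (double m) i)
    ⊎ AbelianSquare (factor s (double m) (i ℕ.+ m))
    ⊎ AbelianSquare (factor s (double m) (i ℕ.+ m ℕ.+ m))
    ⊎ AbelianSquare (factor s (double (double m)) i)
  square-nearby m i with c 0 ℕ.≟ c 1 | c 1 ℕ.≟ c 2 | c 2 ℕ.≟ c 3
    where
    c : ℕ → ℕ
    c 0 = block m i
    c 1 = block m (i ℕ.+ m)
    c 2 = block m (i ℕ.+ m ℕ.+ m)
    c _ = block m (i ℕ.+ m ℕ.+ m ℕ.+ m)
  ... | yes p | _     | _     = inj₁ (equal-blocks⇒square m _ p)
  ... | _     | yes p | _     = inj₂ (inj₁ (equal-blocks⇒square m _ p))
  ... | _     | _     | yes p = inj₂ (inj₂ (inj₁ (equal-blocks⇒square m _ p)))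
  -- With unequal neighbours the four counts alternate as x, y, x, y, and both halves of length 2m
  -- count x + y.
  ... | no p  | no q  | no r  = inj₂ (inj₂ (inj₂ (equal-blocks⇒square (double m) i (begin
    block (double m) i                                                    ≡⟨ block-+ m m i ⟩
    block m i ℕ.+ block m (i ℕ.+ m)                                       ≡⟨ cong₂ ℕ._+_ (alternate p q) (alternate q r) ⟩
    block m (i ℕ.+ m ℕ.+ m) ℕ.+ block m (i ℕ.+ m ℕ.+ m ℕ.+ m)             ≡⟨ block-+ m m (i ℕ.+ m ℕ.+ m) ⟨
    block (double m) (i ℕ.+ m ℕ.+ m)                                      ≡⟨ cong (block (double m)) (ℕ.+-assoc i m m) ⟩
    block (double m) (i ℕ.+ double m)                                     ∎))))
    where
    open ≡-Reasoning
    alternate′ : ∀ {x y z} → x ℕ.< y → y ℕ.≤ suc x → y ℕ.≤ suc z → z ℕ.≤ suc x → y ≢ z → x ≡ z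
    alternate′ {x} {y} {z} x<y y≤1+x y≤1+z z≤1+x y≢z with ℕ.≤-antisym y≤1+x x<y
    ... | refl = ℕ.≤-antisym (ℕ.s≤s⁻¹ y≤1+z) (ℕ.s≤s⁻¹ (ℕ.≤∧≢⇒< z≤1+x (y≢z ∘ sym)))
    alternate : ∀ {i j k} → block m i ≢ block m j → block m j ≢ block m k → block m i ≡ block m k
    alternate {i} {j} {k} p q with ℕ.<-cmp (block m i) (block m j)
    ... | tri< x<y _ _ = alternate′ x<y (blocks-close m j i) (blocks-close m j k) (blocks-close m k i) q
    ... | tri≈ _ x≡y _ = contradiction x≡y p
    ... | tri> _ _ y<x with ℕ.<-cmp (block m j) (block m k)
    ...   | tri< y<z _ _ = ℕ.≤-antisym (ℕ.≤-trans (blocks-close m i j) y<z) (ℕ.≤-trans (blocks-close m k j) y<x)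
    ...   | tri≈ _ y≡z _ = contradiction y≡z q
    ...   | tri> _ _ z<y = contradiction (ℕ.≤-trans (blocks-close m i k) z<y) (ℕ.<⇒≱ y<x)

  -- Each i < L is charged to one of four windows: length 2m from position 0, m or 2m, or length 4m
  -- from position 0. The first three are each bounded by the same `asf (double m)`, whence the
  -- factor 3.
  squares-lower-bound : ∀ {L} m → K ℕ.* L ℕ.≤ m → L ℕ.≤ 3 ℕ.* asf (double m) ℕ.+ asf (double (double m))
  squares-lower-bound {L} m KL≤m = begin
    L                                                                 ≡⟨ List.length-tabulate {n = L} (λ i → i) ⟨
    length (allFin L)                                                 ≤⟨ length≤filter+filter (sq? d 0) _ cover (allFin L) ⟩
    N d 0 ℕ.+ _                                                       ≤⟨ ℕ.+-monoʳ-≤ (N d 0) (length-filter-∪ (sq? d m) _ (allFin L)) ⟩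
    N d 0 ℕ.+ (N d m ℕ.+ _)                                           ≤⟨ ℕ.+-monoʳ-≤ (N d 0) (ℕ.+-monoʳ-≤ (N d m) (length-filter-∪ (sq? d d) (sq? dd 0) (allFin L))) ⟩
    N d 0 ℕ.+ (N d m ℕ.+ (N d d ℕ.+ N dd 0))                          ≤⟨ ℕ.+-mono-≤ (squares-in-window KL≤d 0) (ℕ.+-mono-≤ (squares-in-window KL≤d m)
                                                                           (ℕ.+-mono-≤ (squares-in-window KL≤d d) (squares-in-window KL≤dd 0))) ⟩
    asf d ℕ.+ (asf d ℕ.+ (asf d ℕ.+ asf dd))                          ≡⟨ solve 2 (λ x y → x :+ (x :+ (x :+ y)) := con 3 :* x :+ y) refl (asf d) (asf dd) ⟩
    3 ℕ.* asf d ℕ.+ asf dd                                            ∎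
    where
    open ℕ.≤-Reasoning
    open +-*-Solver
    d = double m
    dd = double d
    KL≤d : K ℕ.* L ℕ.≤ d
    KL≤d = ℕ.≤-trans KL≤m (ℕ.m≤m+n m m)
    KL≤dd : K ℕ.* L ℕ.≤ dd
    KL≤dd = ℕ.≤-trans KL≤d (ℕ.m≤m+n d d)
    sq? : ∀ ℓ k → Decidable (λ (i : Fin L) → AbelianSquare (factor s ℓ (k ℕ.+ toℕ i)))
    sq? ℓ k i = abelianSquare? (factor s ℓ (k ℕ.+ toℕ i))
    N : ℕ → ℕ → ℕ
    N ℓ k = length (filter (sq? ℓ k) (allFin L))
    cover : ∀ i → AbelianSquare (factor s d (toℕ i)) ⊎ AbelianSquare (factor s d (m ℕ.+ toℕ i))
      ⊎ AbelianSquare (factor s d (d ℕ.+ toℕ i)) ⊎ AbelianSquare (factor s dd (toℕ i))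
    cover i = subst₂ (λ x y → AbelianSquare (factor s d (toℕ i)) ⊎ AbelianSquare (factor s d x)
        ⊎ AbelianSquare (factor s d y) ⊎ AbelianSquare (factor s dd (toℕ i)))
      (ℕ.+-comm (toℕ i) m) (trans (ℕ.+-assoc (toℕ i) m m) (ℕ.+-comm (toℕ i) d)) (square-nearby m (toℕ i))

  -- With r = K t, every m in [r, 2r) contributes at least t, and 4m < 8r ≤ n keeps the lengths 2m
  -- and 4m in range. So r t ≤ 4 S, and n ≤ 16 r gives n² ≤ 256 r² = 256 K r t ≤ 1024 K S.
  asf-sum-quadratic : ∀ n → 8 ℕ.* K ℕ.≤ n → n ℕ.* n ℕ.≤ 1024 ℕ.* K ℕ.* Σ< (suc n) asf
  asf-sum-quadratic n 8K≤n = begin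
    n ℕ.* n                                   ≤⟨ ℕ.*-mono-≤ n≤16Kt n≤16Kt ⟩
    (16 ℕ.* r) ℕ.* (16 ℕ.* r)                 ≡⟨ solve 2 (λ k t → (con 16 :* (k :* t)) :* (con 16 :* (k :* t)) := con 256 :* k :* (k :* t :* t)) refl K t ⟩
    256 ℕ.* K ℕ.* (r ℕ.* t)                   ≤⟨ ℕ.*-monoʳ-≤ (256 ℕ.* K) rt≤4S ⟩
    256 ℕ.* K ℕ.* (4 ℕ.* S)                   ≡⟨ solve 2 (λ k s → con 256 :* k :* (con 4 :* s) := con 1024 :* k :* s) refl K S ⟩
    1024 ℕ.* K ℕ.* S                          ∎
    where
    open ℕ.≤-Reasoning
    open +-*-Solver
    instance _ = ℕ.m*n≢0 8 K
    t = n ℕ./ (8 ℕ.* K)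
    r = K ℕ.* t
    S = Σ< (suc n) asf
    8r≤n : double (double (r ℕ.+ r)) ℕ.≤ n
    8r≤n = subst (ℕ._≤ n) (solve 2 (λ k t → t :* (con 8 :* k) := let r = k :* t :+ k :* t in (r :+ r) :+ (r :+ r)) refl K t)
      (ℕ.m/n*n≤m n (8 ℕ.* K))
    n≤16Kt : n ℕ.≤ 16 ℕ.* r
    n≤16Kt = begin
      n                                       ≡⟨ ℕ.m≡m%n+[m/n]*n n (8 ℕ.* K) ⟩
      n ℕ.% (8 ℕ.* K) ℕ.+ t ℕ.* (8 ℕ.* K)     ≤⟨ ℕ.+-monoˡ-≤ _ (ℕ.m%n≤n n (8 ℕ.* K)) ⟩
      -- The hypothesis 8K ≤ n gives t ≥ 1, so 8K is absorbed by a second copy of t * 8K.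
      8 ℕ.* K ℕ.+ t ℕ.* (8 ℕ.* K)             ≤⟨ ℕ.+-monoˡ-≤ _ (ℕ.m≤n*m (8 ℕ.* K) t {{ℕ.>-nonZero (ℕ.m≥n⇒m/n>0 8K≤n)}}) ⟩
      t ℕ.* (8 ℕ.* K) ℕ.+ t ℕ.* (8 ℕ.* K)     ≡⟨ solve 2 (λ k t → t :* (con 8 :* k) :+ t :* (con 8 :* k) := con 16 :* (k :* t)) refl K t ⟩
      16 ℕ.* r                                ∎
    A = Σ< (r ℕ.+ r) (asf ∘ double)
    B = Σ< (r ℕ.+ r) (asf ∘ double ∘ double)
    upTo-n : ∀ {k} → k ℕ.≤ n → Σ< k asf ℕ.≤ S
    upTo-n k≤n = Σ<-monoˡ asf (ℕ.m≤n⇒m≤1+n k≤n)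
    rt≤4S : r ℕ.* t ℕ.≤ 4 ℕ.* S
    rt≤4S = begin
      r ℕ.* t               ≤⟨ Σ<-+-≥ _ r r (λ m r≤m → squares-lower-bound m r≤m) ⟩
      Σ< (r ℕ.+ r) (λ m → 3 ℕ.* asf (double m) ℕ.+ asf (double (double m)))
                            ≡⟨ Σ<-linear (asf ∘ double) (asf ∘ double ∘ double) 3 (r ℕ.+ r) ⟩
      3 ℕ.* A ℕ.+ B         ≤⟨ ℕ.+-mono-≤
                                 (ℕ.*-monoʳ-≤ 3 (ℕ.≤-trans (Σ<-double asf (r ℕ.+ r)) (upTo-n (ℕ.≤-trans (ℕ.m≤m+n (double (r ℕ.+ r)) _) 8r≤n))))
                                 (ℕ.≤-trans (Σ<-double (asf ∘ double) (r ℕ.+ r)) (ℕ.≤-trans (Σ<-double asf (double (r ℕ.+ r))) (upTo-n 8r≤n))) ⟩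
      3 ℕ.* S ℕ.+ S         ≡⟨ solve 1 (λ s → con 3 :* s :+ s := con 4 :* s) refl S ⟩
      4 ℕ.* S               ∎

-- Order of the reals

ℤ-coefficients = CommutativeRing.rawRing ℤ.+-*-commutativeRing

ℚ-ring = ACR.fromCommutativeRing ℚ.+-*-commutativeRing

ι-morphism : ℤ-coefficients ACR.-Raw-AlmostCommutative⟶ ℚ-ring
ι-morphism = record
  { ⟦_⟧ = ι ; +-homo = ι-+ ; *-homo = ι-* ; -‿homo = ι-neg ; 0-homo = refl ; 1-homo = refl }

ι-≟ : ∀ k l → Maybe (ι k ≡ ι l)
ι-≟ k l = Maybe.map (cong ι) (dec⇒maybe (k ℤ.≟ l))

-- Integer coefficients keep the normal forms cheap to compute.
open Algebra.Solver.Ring ℤ-coefficients ℚ-ring ι-morphism ι-≟ using (solve; _:=_; _:+_; _:-_; _:*_; :-_; con)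

private variable
  x y z w : ℝ

-- The order depends only on the termwise differences, so moving terms across an inequality of reals
-- costs one identity of rationals.
<-shift : ∀ {x y x′ y′} → (∀ n → seq y n ℚ.- seq x n ≡ seq y′ n ℚ.- seq x′ n) → x < y → x′ < y′
<-shift {x} {y} {x′} {y′} eq (ε , 0<ε , N , x+ε≤y) = ε , 0<ε , N , λ n N≤n →
  ≤-by (trans (sub-sub (seq y n) (seq x n)) (trans (cong (ℚ._- ε) (eq n)) (sym (sub-sub (seq y′ n) (seq x′ n)))))
    (x+ε≤y n N≤n)
  where
  sub-sub : ∀ p q → p ℚ.- (q ℚ.+ ε) ≡ p ℚ.- q ℚ.- ε
  sub-sub p q = solve 3 (λ p q ε → p :- (q :+ ε) := p :- q :- ε) refl p q ε

≤-shift : ∀ {x y x′ y′} → (∀ n → seq y n ℚ.- seq x n ≡ seq y′ n ℚ.- seq x′ n) → x ≤ y → x′ ≤ y′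
≤-shift {x} {y} {x′} {y′} eq x≤y y′<x′ = x≤y (<-shift {y′} {x′} {y} {x} (λ n →
  trans (flip-sub (seq x′ n) (seq y′ n)) (trans (cong ℚ.-_ (sym (eq n))) (sym (flip-sub (seq x n) (seq y n))))) y′<x′)
  where
  flip-sub : ∀ p q → p ℚ.- q ≡ ℚ.- (q ℚ.- p)
  flip-sub = solve 2 (λ p q → p :- q := :- (q :- p)) refl

eventually-close : ∀ x {δ} → 0ℚ ℚ.< δ → ∃[ N ] ∀ {m n} → N ℕ.≤ m → N ℕ.≤ n → seq x m ℚ.≤ seq x n ℚ.+ δ
eventually-close x {δ} 0<δ with cauchy x δ 0<δ
... | N , near = N , λ {m} {n} N≤m N≤n →
  ≤-by (solve 3 (λ δ p q → δ :- (p :- q) := (q :+ δ) :- p) refl δ (seq x m) (seq x n))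
    (ℚ.≤-trans (p≤∣p∣ _) (ℚ.<⇒≤ (near m n N≤m N≤n)))

half : ∀ {ε} → 0ℚ ℚ.< ε → ∃[ δ ] 0ℚ ℚ.< δ × ε ≡ δ ℚ.+ δ
half {ε} 0<ε = ½ ℚ.* ε , ℚ.*-monoʳ-<-pos ½ 0<ε ,
  sym (trans (sym (ℚ.*-distribʳ-+ ε ½ ½)) (ℚ.*-identityˡ ε))

private
  8• : ℚ → ℚ
  8• δ = δ ℚ.+ δ ℚ.+ (δ ℚ.+ δ) ℚ.+ (δ ℚ.+ δ ℚ.+ (δ ℚ.+ δ))

  -- `y ≤ z` is a negation and supplies no index, but y and z can be compared at one late index M.
  -- Either y exceeds z there by at most 3δ, and passing from y to z costs 5δ out of the gap 8δ; or
  -- it exceeds z by at least 3δ, and z + δ ≤ y holds from M on, which is refuted. The 8 comes from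
  -- halving three times.
  <-≤-trans′ : ∀ {x y z} δ → 0ℚ ℚ.< δ → ∀ N → (∀ n → N ℕ.≤ n → seq x n ℚ.+ 8• δ ℚ.≤ seq y n) → y ≤ z →
    ∃[ Ny ] (∀ {m n} → Ny ℕ.≤ m → Ny ℕ.≤ n → seq y m ℚ.≤ seq y n ℚ.+ δ) →
    ∃[ Nz ] (∀ {m n} → Nz ℕ.≤ m → Nz ℕ.≤ n → seq z m ℚ.≤ seq z n ℚ.+ δ) → x < z
  <-≤-trans′ {x} {y} {z} δ 0<δ N x+ε≤y y≤z (Ny , near-y) (Nz , near-z) =
    conclude (ℚ.≤-total (seq y M) (seq z M ℚ.+ (δ ℚ.+ δ) ℚ.+ δ))
    where
    M = N ℕ.⊔ (Ny ℕ.⊔ Nz)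
    y≤M : Ny ℕ.≤ M
    y≤M = ℕ.≤-trans (ℕ.m≤m⊔n Ny Nz) (ℕ.m≤n⊔m N _)
    z≤M : Nz ℕ.≤ M
    z≤M = ℕ.≤-trans (ℕ.m≤n⊔m Ny Nz) (ℕ.m≤n⊔m N _)
    infixl 5 _⊕_
    _⊕_ : ∀ {p q r s} → p ℚ.≤ q → r ℚ.≤ s → p ℚ.+ r ℚ.≤ q ℚ.+ s
    _⊕_ = ℚ.+-mono-≤
    conclude : seq y M ℚ.≤ seq z M ℚ.+ (δ ℚ.+ δ) ℚ.+ δ ⊎ seq z M ℚ.+ (δ ℚ.+ δ) ℚ.+ δ ℚ.≤ seq y M → x < z
    conclude (inj₁ yM≤) = δ , 0<δ , M , λ n M≤n →
      ≤-by (gap (seq x n) (seq y n) (seq y M) (seq z M) (seq z n) δ)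
        (x+ε≤y n (ℕ.≤-trans (ℕ.m≤m⊔n N _) M≤n)
          ⊕ near-y (ℕ.≤-trans y≤M M≤n) y≤M ⊕ yM≤ ⊕ near-z z≤M (ℕ.≤-trans z≤M M≤n) ⊕ ℚ.<⇒≤ 0<δ ⊕ ℚ.<⇒≤ 0<δ)
      where
      gap : ∀ x y yM zM z δ →
        y ℚ.+ (yM ℚ.+ δ) ℚ.+ (zM ℚ.+ (δ ℚ.+ δ) ℚ.+ δ) ℚ.+ (z ℚ.+ δ) ℚ.+ δ ℚ.+ δ
          ℚ.- (x ℚ.+ (δ ℚ.+ δ ℚ.+ (δ ℚ.+ δ) ℚ.+ (δ ℚ.+ δ ℚ.+ (δ ℚ.+ δ))) ℚ.+ y ℚ.+ yM ℚ.+ zM ℚ.+ 0ℚ ℚ.+ 0ℚ)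
        ≡ z ℚ.- (x ℚ.+ δ)
      gap = solve 6 (λ x y yM zM z δ →
        (y :+ (yM :+ δ) :+ (zM :+ (δ :+ δ) :+ δ) :+ (z :+ δ) :+ δ :+ δ)
          :- (x :+ (δ :+ δ :+ (δ :+ δ) :+ (δ :+ δ :+ (δ :+ δ))) :+ y :+ yM :+ zM :+ con 0ℤ :+ con 0ℤ)
        := z :- (x :+ δ)) refl
    conclude (inj₂ yM≥) = contradiction (δ , 0<δ , M , λ n M≤n →
      ≤-by (gap (seq y n) (seq y M) (seq z M) (seq z n) δ)
        (yM≥ ⊕ near-z (ℕ.≤-trans z≤M M≤n) z≤M ⊕ near-y y≤M (ℕ.≤-trans y≤M M≤n))) y≤z
      where
      gap : ∀ y yM zM z δ →
        yM ℚ.+ (zM ℚ.+ δ) ℚ.+ (y ℚ.+ δ) ℚ.- (zM ℚ.+ (δ ℚ.+ δ) ℚ.+ δ ℚ.+ z ℚ.+ yM) ≡ y ℚ.- (z ℚ.+ δ)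
      gap = solve 5 (λ y yM zM z δ →
        (yM :+ (zM :+ δ) :+ (y :+ δ)) :- (zM :+ (δ :+ δ) :+ δ :+ z :+ yM) := y :- (z :+ δ)) refl

<-≤-trans : x < y → y ≤ z → x < z
<-≤-trans {x} {y} {z} (ε , 0<ε , N , x+ε≤y) y≤z =
  let η , 0<η , ε≡ = half 0<ε
      ζ , 0<ζ , η≡ = half 0<η
      δ , 0<δ , ζ≡ = half 0<ζ
      ε≡8δ = trans ε≡ (cong (λ η → η ℚ.+ η) (trans η≡ (cong (λ ζ → ζ ℚ.+ ζ) ζ≡)))
  in <-≤-trans′ {x} {y} {z} δ 0<δ N
    (λ n N≤n → subst (λ ε → seq x n ℚ.+ ε ℚ.≤ seq y n) ε≡8δ (x+ε≤y n N≤n)) y≤z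
    (eventually-close y 0<δ) (eventually-close z 0<δ)

≤-trans : x ≤ y → y ≤ z → x ≤ z
≤-trans {x} {y} {z} x≤y y≤z z<x = y≤z (<-≤-trans {z} {x} {y} z<x x≤y)

≤-<-trans : x ≤ y → y < z → x < z
≤-<-trans {x} {y} {z} x≤y y<z = <-shift { - z} { - x} {x} {z} (λ n → neg-sub (seq x n) (seq z n))
  (<-≤-trans { - z} { - y} { - x} (<-shift {y} {z} { - z} { - y} (λ n → sym (neg-sub (seq y n) (seq z n))) y<z)
    (≤-shift {x} {y} { - y} { - x} (λ n → sym (neg-sub (seq x n) (seq y n))) x≤y))
  where
  neg-sub : ∀ p q → ℚ.- p ℚ.- ℚ.- q ≡ q ℚ.- p
  neg-sub = solve 2 (λ p q → :- p :- :- q := q :- p) refl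

+-mono-≤ : x ≤ y → z ≤ w → x + z ≤ y + w
+-mono-≤ {x} {y} {z} {w} x≤y z≤w = ≤-trans {x + z} {y + z} {y + w}
  (≤-shift {x} {y} {x + z} {y + z} (λ n → cancel (seq x n) (seq y n) (seq z n)) x≤y)
  (≤-shift {z} {w} {y + z} {y + w} (λ n → cancel′ (seq z n) (seq w n) (seq y n)) z≤w)
  where
  cancel : ∀ p q r → q ℚ.- p ≡ q ℚ.+ r ℚ.- (p ℚ.+ r)
  cancel = solve 3 (λ p q r → q :- p := q :+ r :- (p :+ r)) refl
  cancel′ : ∀ p q r → q ℚ.- p ≡ r ℚ.+ q ℚ.- (r ℚ.+ p)
  cancel′ = solve 3 (λ p q r → q :- p := r :+ q :- (r :+ p)) refl

<⇒≤ : x < y → x ≤ y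
<⇒≤ {x} {y} (ε , 0<ε , M , x+ε≤y) (δ , 0<δ , N , y+δ≤x) = p+ε≰p 0<ε
  (ℚ.≤-trans (x+ε≤y (M ℕ.⊔ N) (ℕ.m≤m⊔n M N)) (ℚ.≤-trans
    (≤-by (solve 2 (λ y δ → δ :- con 0ℤ := (y :+ δ) :- y) refl (seq y (M ℕ.⊔ N)) δ) (ℚ.<⇒≤ 0<δ))
    (y+δ≤x (M ℕ.⊔ N) (ℕ.m≤n⊔m M N))))

≤-refl : ∀ x → x ≤ x
≤-refl x (ε , 0<ε , N , h) = p+ε≰p 0<ε (h N ℕ.≤-refl)

•-mono-≤ : ∀ n → x ≤ y → n • x ≤ n • y
•-mono-≤ zero x≤y = ≤-refl 0ℝ
•-mono-≤ {x} {y} (suc n) x≤y = +-mono-≤ {x} {y} {n • x} {n • y} x≤y (•-mono-≤ {x} {y} n x≤y)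

•-cancel-≤ : ∀ n → suc n • x ≤ suc n • y → x ≤ y
•-cancel-≤ {x} {y} n nx≤ny y<x = nx≤ny (<-≤-trans {y + n • y} {x + n • y} {x + n • x}
  (<-shift {y} {x} {y + n • y} {x + n • y} (λ k → cancel (seq y k) (seq x k) (seq (n • y) k)) y<x)
  (+-mono-≤ {x} {x} {n • y} {n • x} (≤-refl x) (•-mono-≤ {y} {x} n (<⇒≤ {y} {x} y<x))))
  where
  cancel : ∀ p q r → q ℚ.- p ≡ q ℚ.+ r ℚ.- (p ℚ.+ r)
  cancel = solve 3 (λ p q r → q :- p := q :+ r :- (p :+ r)) refl

seq-• : ∀ n x k → seq (n • x) k ≡ ι (+ n) ℚ.* seq x k
seq-• zero    x k = sym (ℚ.*-zeroˡ (seq x k))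
seq-• (suc n) x k = trans (cong (ℚ._+_ (seq x k)) (seq-• n x k))
  (trans (solve 2 (λ n x → x :+ n :* x := (con 1ℤ :+ n) :* x) refl (ι (+ n)) (seq x k))
    (cong (ℚ._* seq x k) (sym (ι-+ 1ℤ (+ n)))))

fromℚ-cancel-≤ : ∀ {p q} → fromℚ p ≤ fromℚ q → p ℚ.≤ q
fromℚ-cancel-≤ {p} {q} p≤q = ℚ.≮⇒≥ λ q<p → p≤q (p ℚ.- q ,
  subst (ℚ._< p ℚ.- q) (ℚ.+-inverseʳ q) (ℚ.+-monoˡ-< (ℚ.- q) q<p) ,
  0 , λ _ _ → ℚ.≤-reflexive (solve 2 (λ p q → q :+ (p :- q) := p) refl p q))

fromℚ-mono-≤ : ∀ {p q} → p ℚ.≤ q → fromℚ p ≤ fromℚ q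
fromℚ-mono-≤ p≤q (ε , 0<ε , N , q+ε≤p) = p+ε≰p 0<ε (ℚ.≤-trans (q+ε≤p N ℕ.≤-refl) p≤q)

fromℤ-cancel-< : ∀ {k l} → fromℤ k < fromℤ (l ℤ.+ 1ℤ) → k ℤ.≤ l
fromℤ-cancel-< {k} {l} k<l+1 = ℤ.≮⇒≥ λ l<k → fromℚ-mono-≤
  (ι-mono (subst (ℤ._≤ k) (ℤ.+-comm 1ℤ l) (ℤ.i<j⇒suc[i]≤j l<k))) k<l+1

-- Heights along the rotation

height-suc : ∀ s m → height s (suc m) ≡ height s m ℤ.+ + occurrences a [ s m ]
height-suc s m = cong +_ (trans (cong (countA s) (sym (ℕ.+-comm m 1))) (trans (countA-+ s m 1)
  (cong (λ n → countA s m ℕ.+ n) (trans (ℕ.+-identityʳ _) (cong (λ i → occurrences a [ s i ]) (ℕ.+-identityʳ m))))))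

height-b : ∀ {s m} → s m ≡ b → height s (suc m) ≡ height s m
height-b {s} {m} eq = trans (height-suc s m)
  (trans (cong (λ l → height s m ℤ.+ + occurrences a [ l ]) eq) (ℤ.+-identityʳ _))

height-a : ∀ {s m} → s m ≡ a → height s (suc m) ≡ height s m ℤ.+ 1ℤ
height-a {s} {m} eq = trans (height-suc s m) (cong (λ l → height s m ℤ.+ + occurrences a [ l ]) eq)

letter : ∀ l → l ≡ a ⊎ l ≡ b
letter a = inj₁ refl
letter b = inj₂ refl

¬b⇒¬¬ : ∀ I α ρ {s} → RotationWord I α ρ s → ∀ m → s m ≡ b →
  ¬ ¬ FracIn I (ρ + m • α)
¬b⇒¬¬ I α ρ word m sm≡b ¬in = case trans (sym sm≡b) (word m .proj₂ ¬in) of λ ()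

a⇒¬ : ∀ I α ρ {s} → RotationWord I α ρ s → ∀ m → s m ≡ a →
  ¬ FracIn I (ρ + m • α)
a⇒¬ I α ρ word m sm≡a in′ = case trans (sym sm≡a) (word m .proj₁ in′) of λ ()

floor≤ : ∀ x {k l} → fromℤ k ≤ x → x < fromℤ (l ℤ.+ 1ℤ) → k ℤ.≤ l
floor≤ x {k} {l} k≤x x<l+1 = fromℤ-cancel-< (≤-<-trans {fromℤ k} {x} {fromℤ (l ℤ.+ 1ℤ)} k≤x x<l+1)

<-floor : ∀ x {k l} → fromℤ k < x → x ≤ fromℤ (l ℤ.+ 1ℤ) → k ℤ.≤ l
<-floor x {k} {l} k<x x≤l+1 = fromℤ-cancel-< (<-≤-trans {fromℤ k} {x} {fromℤ (l ℤ.+ 1ℤ)} k<x x≤l+1)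

module _ {α ρ : ℝ} (0<α : 0ℝ < α) (α<1 : α < 1ℝ) where

  private
    orbit : ℕ → ℝ
    orbit m = ρ + m • α

  orbit-suc-shift : ∀ m k → seq (orbit (suc m)) k ≡ seq (orbit m) k ℚ.+ seq α k
  orbit-suc-shift m k = eq (seq ρ k) (seq α k) (seq (m • α) k)
    where
    eq : ∀ r x y → r ℚ.+ (x ℚ.+ y) ≡ r ℚ.+ y ℚ.+ x
    eq = solve 3 (λ r x y → r :+ (x :+ y) := r :+ y :+ x) refl

  orbit-mono : ∀ m → orbit m < orbit (suc m)
  orbit-mono m = <-shift {0ℝ} {α} {orbit m} {orbit (suc m)}
    (λ k → trans (eq (seq α k) (seq (orbit m) k)) (cong (ℚ._- seq (orbit m) k) (sym (orbit-suc-shift m k)))) 0<α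
    where
    eq : ∀ x y → x ℚ.- 0ℚ ≡ y ℚ.+ x ℚ.- y
    eq = solve 2 (λ x y → x :- con 0ℤ := y :+ x :- y) refl

  orbit-suc< : ∀ m k → orbit m < fromℤ k → orbit (suc m) < fromℤ (k ℤ.+ 1ℤ)
  orbit-suc< m k x<k = <-≤-trans {orbit (suc m)} {fromℤ k + α} {fromℤ (k ℤ.+ 1ℤ)}
    (<-shift {orbit m} {fromℤ k} {orbit (suc m)} {fromℤ k + α}
      (λ n → trans (eq (ι k) (seq (orbit m) n) (seq α n))
        (cong (λ y → ι k ℚ.+ seq α n ℚ.- y) (sym (orbit-suc-shift m n)))) x<k)
    (<⇒≤ {fromℤ k + α} {fromℤ (k ℤ.+ 1ℤ)} (<-shift {α} {1ℝ} {fromℤ k + α} {fromℤ (k ℤ.+ 1ℤ)}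
      (λ n → trans (eq′ (ι k) (seq α n)) (cong (ℚ._- (ι k ℚ.+ seq α n)) (sym (ι-+ k 1ℤ)))) α<1))
    where
    eq : ∀ k x y → k ℚ.- x ≡ k ℚ.+ y ℚ.- (x ℚ.+ y)
    eq = solve 3 (λ k x y → k :- x := k :+ y :- (x :+ y)) refl
    eq′ : ∀ k x → 1ℚ ℚ.- x ≡ k ℚ.+ 1ℚ ℚ.- (k ℚ.+ x)
    eq′ = solve 2 (λ k x → con 1ℤ :- x := k :+ con 1ℤ :- (k :+ x)) refl

  orbit-suc≤ : ∀ m k → orbit m ≤ fromℤ k → orbit (suc m) ≤ fromℤ (k ℤ.+ 1ℤ)
  orbit-suc≤ m k x≤k = ≤-shift {orbit m + α} {fromℤ k + 1ℝ} {orbit (suc m)} {fromℤ (k ℤ.+ 1ℤ)}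
    (λ n → cong₂ ℚ._-_ (sym (ι-+ k 1ℤ)) (sym (orbit-suc-shift m n)))
    (+-mono-≤ {orbit m} {fromℤ k} {α} {1ℝ} x≤k (<⇒≤ {α} {1ℝ} α<1))

  -- Comparing x - k with 1 - α amounts to comparing x + α with k + 1: the letter b means that the
  -- step does not reach the next integer.
  next-gap : ∀ m k n →
    seq (1ℝ - α) n ℚ.- seq (orbit m - fromℤ k) n ≡ seq (fromℤ (k ℤ.+ 1ℤ)) n ℚ.- seq (orbit (suc m)) n
  next-gap m k n = trans (eq (ι k) (seq (orbit m) n) (seq α n))
    (cong₂ ℚ._-_ (sym (ι-+ k 1ℤ)) (sym (orbit-suc-shift m n)))
    where
    eq : ∀ k x y → 1ℚ ℚ.- y ℚ.- (x ℚ.- k) ≡ k ℚ.+ 1ℚ ℚ.- (x ℚ.+ y)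
    eq = solve 3 (λ k x y → con 1ℤ :- y :- (x :- k) := k :+ con 1ℤ :- (x :+ y)) refl

  frac-gap : ∀ m k n → seq (orbit m) n ℚ.- seq (fromℤ k) n ≡ seq (orbit m - fromℤ k) n ℚ.- seq 0ℝ n
  frac-gap m k n = sym (ℚ.+-identityʳ _)

  orbit-0-gap : ∀ k n → seq ρ n ℚ.- seq (fromℤ k) n ≡ seq (orbit 0) n ℚ.- seq (fromℤ k) n
  orbit-0-gap k n = cong (ℚ._- ι k) (sym (ℚ.+-identityʳ (seq ρ n)))

  orbit-0-gap′ : ∀ k n → seq (fromℤ k) n ℚ.- seq ρ n ≡ seq (fromℤ k) n ℚ.- seq (orbit 0) n
  orbit-0-gap′ k n = cong (λ x → ι k ℚ.- x) (sym (ℚ.+-identityʳ (seq ρ n)))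

  module _ {s : InfiniteWord} where

    -- The letter a marks the steps that reach a new integer, so the number of letters a is the
    -- floor of the orbit. The double negation is due to the letter b, which only refutes that the
    -- point lies outside the interval.
    height-floor : RotationWord [ 0ℝ , 1ℝ - α ⟩ α ρ s → [ 0ℝ , 1ℝ ⟩ ρ →
      ∀ m → ¬ ¬ (height s m IsFloorOf orbit m)
    height-floor word (0≤ρ , ρ<1) zero ¬floor = ¬floor
      ( ≤-shift {0ℝ} {ρ} {0ℝ} {orbit 0} (orbit-0-gap 0ℤ) 0≤ρ
      , <-shift {ρ} {1ℝ} {orbit 0} {1ℝ} (orbit-0-gap′ 1ℤ) ρ<1)
    height-floor word ρ∈ (suc m) ¬floor = height-floor word ρ∈ m λ (k≤x , x<k+1) →
      [ (λ sm≡a → ¬floor (subst (_IsFloorOf orbit (suc m)) (sym (height-a {s} sm≡a))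
          ( (λ x′<k+1 → a⇒¬ [ 0ℝ , 1ℝ - α ⟩ α ρ word m sm≡a (k , (k≤x , x<k+1) ,
              ≤-shift {fromℤ k} {orbit m} {0ℝ} {orbit m - fromℤ k} (frac-gap m k) k≤x ,
              <-shift {orbit (suc m)} {fromℤ (k ℤ.+ 1ℤ)} {orbit m - fromℤ k} {1ℝ - α} (sym ∘ next-gap m k) x′<k+1))
          , orbit-suc< m (k ℤ.+ 1ℤ) x<k+1)))
      , (λ sm≡b → ¬b⇒¬¬ [ 0ℝ , 1ℝ - α ⟩ α ρ word m sm≡b λ (l , (l≤x , x<l+1) , _ , small) →
          -- Membership in the interval brings its own floor l, which must be identified with k.
          let k≡l = ℤ.≤-antisym (floor≤ (orbit m) {k} {l} k≤x x<l+1) (floor≤ (orbit m) {l} {k} l≤x x<k+1) in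
          ¬floor (subst (_IsFloorOf orbit (suc m)) (sym (height-b {s} sm≡b))
            ( ≤-trans {fromℤ k} {orbit m} {orbit (suc m)} k≤x (<⇒≤ {orbit m} {orbit (suc m)} (orbit-mono m))
            , subst (λ l → orbit (suc m) < fromℤ (l ℤ.+ 1ℤ)) (sym k≡l)
                (<-shift {orbit m - fromℤ l} {1ℝ - α} {orbit (suc m)} {fromℤ (l ℤ.+ 1ℤ)} (next-gap m l) small))))
      ]′ (letter (s m))
      where k = height s m

    -- In the other convention the height follows the ceiling minus 1, up to the offset z. For ρ in
    -- [0, 1) this z is 0 if ρ is positive and -1 if ρ is 0.
    height-ceiling : RotationWord ⟨ 0ℝ , 1ℝ - α ] α ρ s → ∀ z → fromℤ z < ρ → ρ ≤ fromℤ (z ℤ.+ 1ℤ) →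
      ∀ m → ¬ ¬ (fromℤ (z ℤ.+ height s m) < orbit m × orbit m ≤ fromℤ (z ℤ.+ height s m ℤ.+ 1ℤ))
    height-ceiling word z z<ρ ρ≤z+1 zero ¬ceiling = ¬ceiling
      (subst (λ k → fromℤ k < orbit 0 × orbit 0 ≤ fromℤ (k ℤ.+ 1ℤ)) (sym (ℤ.+-identityʳ z))
        ( <-shift {fromℤ z} {ρ} {fromℤ z} {orbit 0} (orbit-0-gap z) z<ρ
        , ≤-shift {ρ} {fromℤ (z ℤ.+ 1ℤ)} {orbit 0} {fromℤ (z ℤ.+ 1ℤ)} (orbit-0-gap′ (z ℤ.+ 1ℤ)) ρ≤z+1))
    height-ceiling word z z<ρ ρ≤z+1 (suc m) ¬ceiling = height-ceiling word z z<ρ ρ≤z+1 m λ (k<x , x≤k+1) →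
      [ (λ sm≡a →
          let x′≤k+2 = orbit-suc≤ m (k ℤ.+ 1ℤ) x≤k+1
              -- The new lower bound is strict, hence not a negation, and is not proved directly:
              -- `¬ceiling` refutes it, which puts the point in the interval of b.
              x′≤k+1 = λ k+1<x′ → ¬ceiling (subst Ceiling (trans (ℤ.+-assoc z (height s m) 1ℤ)
                (cong (λ n → z ℤ.+ n) (sym (height-a {s} sm≡a)))) (k+1<x′ , x′≤k+2))
          in a⇒¬ ⟨ 0ℝ , 1ℝ - α ] α ρ word m sm≡a (k ,
            ( <⇒≤ {fromℤ k} {orbit m} k<x
            , <-≤-trans {orbit m} {orbit (suc m)} {fromℤ (k ℤ.+ 1ℤ)} (orbit-mono m) x′≤k+1) ,
            <-shift {fromℤ k} {orbit m} {0ℝ} {orbit m - fromℤ k} (frac-gap m k) k<x ,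
            ≤-shift {orbit (suc m)} {fromℤ (k ℤ.+ 1ℤ)} {orbit m - fromℤ k} {1ℝ - α} (sym ∘ next-gap m k) x′≤k+1))
      , (λ sm≡b → ¬b⇒¬¬ ⟨ 0ℝ , 1ℝ - α ] α ρ word m sm≡b λ (l , (l≤x , x<l+1) , 0<x-l , small) →
          let l<x = <-shift {0ℝ} {orbit m - fromℤ l} {fromℤ l} {orbit m} (sym ∘ frac-gap m l) 0<x-l
              k≡l = ℤ.≤-antisym (floor≤ (orbit m) {k} {l} (<⇒≤ {fromℤ k} {orbit m} k<x) x<l+1) (<-floor (orbit m) {l} {k} l<x x≤k+1)
          in ¬ceiling (subst Ceiling (cong (λ n → z ℤ.+ n) (sym (height-b {s} sm≡b)))
            ( <-≤-trans {fromℤ k} {orbit m} {orbit (suc m)} k<x (<⇒≤ {orbit m} {orbit (suc m)} (orbit-mono m))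
            , subst (λ l → orbit (suc m) ≤ fromℤ (l ℤ.+ 1ℤ)) (sym k≡l)
                (≤-shift {orbit m - fromℤ l} {1ℝ - α} {orbit (suc m)} {fromℤ (l ℤ.+ 1ℤ)} (next-gap m l) small))))
      ]′ (letter (s m))
      where
      k = z ℤ.+ height s m
      Ceiling : ℤ → Set
      Ceiling k = fromℤ k < orbit (suc m) × orbit (suc m) ≤ fromℤ (k ℤ.+ 1ℤ)

    -- The weak bounds are common to both conventions, and z will cancel in increments.
    height-tracks : [ 0ℝ , 1ℝ ⟩ ρ → RotationWord [ 0ℝ , 1ℝ - α ⟩ α ρ s ⊎ RotationWord ⟨ 0ℝ , 1ℝ - α ] α ρ s →
      ¬ ¬ (∃[ z ] ∀ m → fromℤ (z ℤ.+ height s m) ≤ orbit m × orbit m ≤ fromℤ (z ℤ.+ height s m ℤ.+ 1ℤ))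
    height-tracks ρ∈ (inj₁ word) ¬tracks = ¬tracks (0ℤ , λ m →
      (λ lt → height-floor word ρ∈ m λ (k≤x , _) → k≤x lt) ,
      (λ lt → height-floor word ρ∈ m λ (_ , x<k+1) → <⇒≤ {orbit m} {fromℤ (height s m ℤ.+ 1ℤ)} x<k+1 lt))
    -- Whether ρ is positive cannot be decided, but as the goal is absurdity it suffices to refute
    -- both answers.
    height-tracks (0≤ρ , ρ<1) (inj₂ word) ¬tracks = ρ≤0 0<ρ→⊥
      where
      from-ceiling : ∀ z → fromℤ z < ρ → ρ ≤ fromℤ (z ℤ.+ 1ℤ) → ⊥
      from-ceiling z z<ρ ρ≤z+1 = ¬tracks (z , λ m →
        (λ lt → height-ceiling word z z<ρ ρ≤z+1 m λ (k<x , _) → <⇒≤ {fromℤ (z ℤ.+ height s m)} {orbit m} k<x lt) ,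
        (λ lt → height-ceiling word z z<ρ ρ≤z+1 m λ (_ , x≤k+1) → x≤k+1 lt))
      0<ρ→⊥ : ¬ (0ℝ < ρ)
      0<ρ→⊥ 0<ρ = from-ceiling 0ℤ 0<ρ (<⇒≤ {ρ} {1ℝ} ρ<1)
      ρ≤0 : ¬ ¬ (0ℝ < ρ)
      ρ≤0 ρ≤0 = from-ceiling (ℤ.- 1ℤ)
        (<-≤-trans {fromℤ (ℤ.- 1ℤ)} {0ℝ} {ρ} (1ℚ , ℚ.positive⁻¹ 1ℚ , 0 , λ _ _ → ℚ.≤-refl) 0≤ρ) ρ≤0

    increment-bounds : [ 0ℝ , 1ℝ ⟩ ρ → RotationWord [ 0ℝ , 1ℝ - α ⟩ α ρ s ⊎ RotationWord ⟨ 0ℝ , 1ℝ - α ] α ρ s →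
      ∀ i j → let c = height s (i ℕ.+ j) ℤ.- height s i in
      j • α ≤ fromℤ (c ℤ.+ 1ℤ) × fromℤ (c ℤ.- 1ℤ) ≤ j • α
    increment-bounds ρ∈ word i j =
      -- Assuming `lt` makes absurdity the goal, which gives access to the z hidden by the double
      -- negation.
      (λ lt → height-tracks ρ∈ word λ (z , tracks) →
        ≤-shift {fromℤ (z ℤ.+ u) + orbit (i ℕ.+ j)} {orbit i + fromℤ (z ℤ.+ v ℤ.+ 1ℤ)} {j • α} {fromℤ (v ℤ.- u ℤ.+ 1ℤ)}
          (gap z)
          (+-mono-≤ {fromℤ (z ℤ.+ u)} {orbit i} {orbit (i ℕ.+ j)} {fromℤ (z ℤ.+ v ℤ.+ 1ℤ)} (tracks i .proj₁) (tracks (i ℕ.+ j) .proj₂))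
          lt) ,
      (λ lt → height-tracks ρ∈ word λ (z , tracks) →
        ≤-shift {fromℤ (z ℤ.+ v) + orbit i} {orbit (i ℕ.+ j) + fromℤ (z ℤ.+ u ℤ.+ 1ℤ)} {fromℤ (v ℤ.- u ℤ.- 1ℤ)} {j • α}
          (gap′ z)
          (+-mono-≤ {fromℤ (z ℤ.+ v)} {orbit (i ℕ.+ j)} {orbit i} {fromℤ (z ℤ.+ u ℤ.+ 1ℤ)} (tracks (i ℕ.+ j) .proj₁) (tracks i .proj₂))
          lt)
      where
      u = height s i
      v = height s (i ℕ.+ j)
      seq-orbit : ∀ i n → seq (orbit i) n ≡ seq ρ n ℚ.+ ι (+ i) ℚ.* seq α n
      seq-orbit i n = cong (λ x → seq ρ n ℚ.+ x) (seq-• i α n)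
      seq-orbit-+ : ∀ n → seq (orbit (i ℕ.+ j)) n ≡ seq ρ n ℚ.+ (ι (+ i) ℚ.+ ι (+ j)) ℚ.* seq α n
      seq-orbit-+ n = trans (seq-orbit (i ℕ.+ j) n) (cong (λ x → seq ρ n ℚ.+ x ℚ.* seq α n) (ι-+ (+ i) (+ j)))
      eq : ∀ z u v r i j x →
        r ℚ.+ i ℚ.* x ℚ.+ (z ℚ.+ v ℚ.+ 1ℚ) ℚ.- (z ℚ.+ u ℚ.+ (r ℚ.+ (i ℚ.+ j) ℚ.* x))
        ≡ v ℚ.- u ℚ.+ 1ℚ ℚ.- j ℚ.* x
      eq = solve 7 (λ z u v r i j x →
        r :+ i :* x :+ (z :+ v :+ con 1ℤ) :- (z :+ u :+ (r :+ (i :+ j) :* x)) := v :- u :+ con 1ℤ :- j :* x) refl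
      eq′ : ∀ z u v r i j x →
        r ℚ.+ (i ℚ.+ j) ℚ.* x ℚ.+ (z ℚ.+ u ℚ.+ 1ℚ) ℚ.- (z ℚ.+ v ℚ.+ (r ℚ.+ i ℚ.* x))
        ≡ j ℚ.* x ℚ.- (v ℚ.- u ℚ.- 1ℚ)
      eq′ = solve 7 (λ z u v r i j x →
        r :+ (i :+ j) :* x :+ (z :+ u :+ con 1ℤ) :- (z :+ v :+ (r :+ i :* x)) := j :* x :- (v :- u :- con 1ℤ)) refl
      ι-z+u+1 : ∀ z u → ι (z ℤ.+ u ℤ.+ 1ℤ) ≡ ι z ℚ.+ ι u ℚ.+ 1ℚ
      ι-z+u+1 z u = trans (ι-+ (z ℤ.+ u) 1ℤ) (cong (ℚ._+ 1ℚ) (ι-+ z u))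
      gap : ∀ z n → seq (orbit i + fromℤ (z ℤ.+ v ℤ.+ 1ℤ)) n ℚ.- seq (fromℤ (z ℤ.+ u) + orbit (i ℕ.+ j)) n
        ≡ seq (fromℤ (v ℤ.- u ℤ.+ 1ℤ)) n ℚ.- seq (j • α) n
      gap z n = trans
        (cong₂ ℚ._-_ (cong₂ ℚ._+_ (seq-orbit i n) (ι-z+u+1 z v)) (cong₂ ℚ._+_ (ι-+ z u) (seq-orbit-+ n)))
        (trans (eq (ι z) (ι u) (ι v) (seq ρ n) (ι (+ i)) (ι (+ j)) (seq α n))
          (sym (cong₂ ℚ._-_ (trans (ι-+ (v ℤ.- u) 1ℤ) (cong (ℚ._+ 1ℚ) (ι-- v u))) (seq-• j α n))))
      gap′ : ∀ z n → seq (orbit (i ℕ.+ j) + fromℤ (z ℤ.+ u ℤ.+ 1ℤ)) n ℚ.- seq (fromℤ (z ℤ.+ v) + orbit i) n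
        ≡ seq (j • α) n ℚ.- seq (fromℤ (v ℤ.- u ℤ.- 1ℤ)) n
      gap′ z n = trans
        (cong₂ ℚ._-_ (cong₂ ℚ._+_ (seq-orbit-+ n) (ι-z+u+1 z u)) (cong₂ ℚ._+_ (ι-+ z v) (seq-orbit i n)))
        (trans (eq′ (ι z) (ι u) (ι v) (seq ρ n) (ι (+ i)) (ι (+ j)) (seq α n))
          (sym (cong₂ ℚ._-_ (seq-• j α n) (trans (ι-- (v ℤ.- u) 1ℤ) (cong (ℚ._- 1ℚ) (ι-- v u))))))

-- Continued fractions

limit-≥ : ∀ {c x} → c ⟶ x → ∀ N {q} → (∀ n → q ℚ.≤ c (N ℕ.+ n)) → fromℚ q ≤ x
limit-≥ {c} {x} c⟶x N {q} q≤c (ε , 0<ε , K , x+ε≤q) =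
  let N′ , near = c⟶x ε 0<ε
      n = N ℕ.+ N′
      (δ , 0<δ , L , c-ε+δ≤x) , _ = near n (ℕ.m≤n+m N′ N)
      k = K ℕ.⊔ L
  in p+ε≰p {c n} 0<δ (≤-by (gap (c n) δ ε (seq x k) q)
       (ℚ.+-mono-≤ (ℚ.+-mono-≤ (c-ε+δ≤x k (ℕ.m≤n⊔m K L)) (x+ε≤q k (ℕ.m≤m⊔n K L))) (q≤c N′)))
  where
  gap : ∀ c δ ε x q → x ℚ.+ q ℚ.+ c ℚ.- (c ℚ.- ε ℚ.+ δ ℚ.+ (x ℚ.+ ε) ℚ.+ q) ≡ c ℚ.- (c ℚ.+ δ)
  gap = solve 5 (λ c δ ε x q → x :+ q :+ c :- (c :- ε :+ δ :+ (x :+ ε) :+ q) := c :- (c :+ δ)) refl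

limit-≤ : ∀ {c x} → c ⟶ x → ∀ N {q} → (∀ n → c (N ℕ.+ n) ℚ.≤ q) → x ≤ fromℚ q
limit-≤ {c} {x} c⟶x N {q} c≤q (ε , 0<ε , K , q+ε≤x) =
  let N′ , near = c⟶x ε 0<ε
      n = N ℕ.+ N′
      _ , (δ , 0<δ , L , x+δ≤c+ε) = near n (ℕ.m≤n+m N′ N)
      k = K ℕ.⊔ L
  in p+ε≰p {q} 0<δ (≤-by (gap (c n) δ ε (seq x k) q)
       (ℚ.+-mono-≤ (ℚ.+-mono-≤ (x+δ≤c+ε k (ℕ.m≤n⊔m K L)) (q+ε≤x k (ℕ.m≤m⊔n K L))) (c≤q N′)))
  where
  gap : ∀ c δ ε x q → c ℚ.+ ε ℚ.+ x ℚ.+ q ℚ.- (x ℚ.+ δ ℚ.+ (q ℚ.+ ε) ℚ.+ c) ≡ q ℚ.- (q ℚ.+ δ)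
  gap = solve 5 (λ c δ ε x q → c :+ ε :+ x :+ q :- (x :+ δ :+ (q :+ ε) :+ c) := q :- (q :+ δ)) refl

0<ι : ∀ {k} → 1ℤ ℤ.≤ k → 0ℚ ℚ.< ι k
0<ι 1≤k = ℚ.<-≤-trans (ℚ.positive⁻¹ 1ℚ) (ι-mono 1≤k)

0<+ : ∀ {p q} → 0ℚ ℚ.< p → 0ℚ ℚ.< q → 0ℚ ℚ.< p ℚ.+ q
0<+ = ℚ.+-mono-<

0<convergent : ∀ {r} → (∀ i → 1ℤ ℤ.≤ r i) → ∀ n → 0ℚ ℚ.< convergent r n
0<convergent 1≤r zero    = 0<ι (1≤r 0)
0<convergent 1≤r (suc n) = 0<+ (0<ι (1≤r 0)) (0<recip (0<convergent (1≤r ∘ suc) n))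

-- T = v z + 1 clears the nested fraction: (v + 1/z) z = T, hence y T = u T + z. The claim is the
-- relation for y multiplied by T.
möbius-step : ∀ {c P Q P′ Q′ y z} u v → 0ℚ ℚ.< v ℚ.+ recip z → 0ℚ ℚ.< z →
  y ≡ u ℚ.+ recip (v ℚ.+ recip z) → c ℚ.* (Q′ ℚ.* y ℚ.+ Q) ≡ P′ ℚ.* y ℚ.+ P →
  c ℚ.* ((v ℚ.* (u ℚ.* Q′ ℚ.+ Q) ℚ.+ Q′) ℚ.* z ℚ.+ (u ℚ.* Q′ ℚ.+ Q))
    ≡ (v ℚ.* (u ℚ.* P′ ℚ.+ P) ℚ.+ P′) ℚ.* z ℚ.+ (u ℚ.* P′ ℚ.+ P)
möbius-step {c} {P} {Q} {P′} {Q′} {y} {z} u v 0<t 0<z y≡ eq = begin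
  c ℚ.* ((v ℚ.* (u ℚ.* Q′ ℚ.+ Q) ℚ.+ Q′) ℚ.* z ℚ.+ (u ℚ.* Q′ ℚ.+ Q))   ≡⟨ cong (c ℚ.*_) (expand Q Q′ u v z) ⟩
  c ℚ.* (Q′ ℚ.* (u ℚ.* T ℚ.+ z) ℚ.+ Q ℚ.* T)                           ≡⟨ cong (λ w → c ℚ.* (Q′ ℚ.* w ℚ.+ Q ℚ.* T)) y*T≡ ⟨
  c ℚ.* (Q′ ℚ.* (y ℚ.* T) ℚ.+ Q ℚ.* T)                                 ≡⟨ factor-out c Q Q′ y T ⟩
  c ℚ.* (Q′ ℚ.* y ℚ.+ Q) ℚ.* T                                         ≡⟨ cong (ℚ._* T) eq ⟩
  (P′ ℚ.* y ℚ.+ P) ℚ.* T                                               ≡⟨ distribute P P′ y T ⟩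
  P′ ℚ.* (y ℚ.* T) ℚ.+ P ℚ.* T                                         ≡⟨ cong (λ w → P′ ℚ.* w ℚ.+ P ℚ.* T) y*T≡ ⟩
  P′ ℚ.* (u ℚ.* T ℚ.+ z) ℚ.+ P ℚ.* T                                   ≡⟨ expand P P′ u v z ⟨
  (v ℚ.* (u ℚ.* P′ ℚ.+ P) ℚ.+ P′) ℚ.* z ℚ.+ (u ℚ.* P′ ℚ.+ P)           ∎
  where
  open ≡-Reasoning
  t = v ℚ.+ recip z
  T = v ℚ.* z ℚ.+ 1ℚ
  expand : ∀ X X′ u v z → (v ℚ.* (u ℚ.* X′ ℚ.+ X) ℚ.+ X′) ℚ.* z ℚ.+ (u ℚ.* X′ ℚ.+ X)
    ≡ X′ ℚ.* (u ℚ.* (v ℚ.* z ℚ.+ 1ℚ) ℚ.+ z) ℚ.+ X ℚ.* (v ℚ.* z ℚ.+ 1ℚ)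
  expand = solve 5 (λ X X′ u v z → (v :* (u :* X′ :+ X) :+ X′) :* z :+ (u :* X′ :+ X)
    := X′ :* (u :* (v :* z :+ con 1ℤ) :+ z) :+ X :* (v :* z :+ con 1ℤ)) refl
  factor-out : ∀ c Q Q′ y T → c ℚ.* (Q′ ℚ.* (y ℚ.* T) ℚ.+ Q ℚ.* T) ≡ c ℚ.* (Q′ ℚ.* y ℚ.+ Q) ℚ.* T
  factor-out = solve 5 (λ c Q Q′ y T → c :* (Q′ :* (y :* T) :+ Q :* T) := c :* (Q′ :* y :+ Q) :* T) refl
  distribute : ∀ P P′ y T → (P′ ℚ.* y ℚ.+ P) ℚ.* T ≡ P′ ℚ.* (y ℚ.* T) ℚ.+ P ℚ.* T
  distribute = solve 4 (λ P P′ y T → (P′ :* y :+ P) :* T := P′ :* (y :* T) :+ P :* T) refl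
  t*z≡T : t ℚ.* z ≡ T
  t*z≡T = trans (ℚ.*-distribʳ-+ z v (recip z)) (cong (λ x → v ℚ.* z ℚ.+ x) (recip-inverse 0<z))
  y*T≡ : y ℚ.* T ≡ u ℚ.* T ℚ.+ z
  y*T≡ = begin
    y ℚ.* T                                 ≡⟨ cong (ℚ._* T) y≡ ⟩
    (u ℚ.+ recip t) ℚ.* T                   ≡⟨ ℚ.*-distribʳ-+ T u (recip t) ⟩
    u ℚ.* T ℚ.+ recip t ℚ.* T               ≡⟨ cong (λ w → u ℚ.* T ℚ.+ recip t ℚ.* w) t*z≡T ⟨
    u ℚ.* T ℚ.+ recip t ℚ.* (t ℚ.* z)       ≡⟨ cong (λ w → u ℚ.* T ℚ.+ w) (ℚ.*-assoc (recip t) t z) ⟨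
    u ℚ.* T ℚ.+ recip t ℚ.* t ℚ.* z         ≡⟨ cong (λ w → u ℚ.* T ℚ.+ w ℚ.* z) (recip-inverse 0<t) ⟩
    u ℚ.* T ℚ.+ 1ℚ ℚ.* z                    ≡⟨ cong (λ w → u ℚ.* T ℚ.+ w) (ℚ.*-identityˡ z) ⟩
    u ℚ.* T ℚ.+ z                           ∎

-- Eventually the convergents c are the images of the convergents of the tail r
-- under the Möbius transformation y ↦ (P′ y + P) / (Q′ y + Q).
Tracks : (ℕ → ℚ) → (P Q P′ Q′ : ℤ) → (ℕ → ℤ) → Set
Tracks c P Q P′ Q′ r = ∃[ N ] ∀ n → let y = convergent r n in
  c (N ℕ.+ n) ℚ.* (ι Q′ ℚ.* y ℚ.+ ι Q) ≡ ι P′ ℚ.* y ℚ.+ ι P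

-- Two partial quotients are absorbed at once, because a single one would swap the lower and upper
-- sides and the sign of the determinant. Positivity is asked from `r 1` on, as the first use has a₀
-- for `r 0`.
tracks-step : ∀ {c P Q P′ Q′} r → (∀ i → 1ℤ ℤ.≤ r (suc i)) → Tracks c P Q P′ Q′ r →
  let P″ = r 0 ℤ.* P′ ℤ.+ P ; Q″ = r 0 ℤ.* Q′ ℤ.+ Q in
  Tracks c P″ Q″ (r 1 ℤ.* P″ ℤ.+ P′) (r 1 ℤ.* Q″ ℤ.+ Q′) (r ∘ suc ∘ suc)
tracks-step {c} {P} {Q} {P′} {Q′} r 1≤r (N , tracks) = suc (suc N) , λ n →
  let z = convergent (r ∘ suc ∘ suc) n
      0<z = 0<convergent (λ i → 1≤r (suc i)) n
      c′ = c (suc (suc N) ℕ.+ n)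
      y = convergent r (suc (suc n))
  in subst₂ (λ x w → c′ ℚ.* x ≡ w) (cast Q Q′ z) (cast P P′ z)
    (möbius-step {c′} {ι P} {ι Q} {ι P′} {ι Q′} {y} {z} (ι (r 0)) (ι (r 1)) (0<+ (0<ι (1≤r 0)) (0<recip 0<z)) 0<z refl
      (subst (λ k → c k ℚ.* (ι Q′ ℚ.* y ℚ.+ ι Q) ≡ ι P′ ℚ.* y ℚ.+ ι P)
        (trans (ℕ.+-suc N (suc n)) (cong suc (ℕ.+-suc N n))) (tracks (suc (suc n)))))
  where
  ι-affine : ∀ u X Y → ι (u ℤ.* X ℤ.+ Y) ≡ ι u ℚ.* ι X ℚ.+ ι Y
  ι-affine u X Y = trans (ι-+ (u ℤ.* X) Y) (cong (ℚ._+ ι Y) (ι-* u X))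
  cast : ∀ X X′ z → (ι (r 1) ℚ.* (ι (r 0) ℚ.* ι X′ ℚ.+ ι X) ℚ.+ ι X′) ℚ.* z ℚ.+ (ι (r 0) ℚ.* ι X′ ℚ.+ ι X)
    ≡ ι (r 1 ℤ.* (r 0 ℤ.* X′ ℤ.+ X) ℤ.+ X′) ℚ.* z ℚ.+ ι (r 0 ℤ.* X′ ℤ.+ X)
  cast X X′ z = sym (cong₂ (λ p q → p ℚ.* z ℚ.+ q)
    (trans (ι-affine (r 1) _ X′) (cong (λ w → ι (r 1) ℚ.* w ℚ.+ ι X′) (ι-affine (r 0) X′ X)))
    (ι-affine (r 0) X′ X))

-- P/Q and P′/Q′ are consecutive convergents, of even and of odd index, and `rest` holds the partial
-- quotients after them.
record Bracket (c : ℕ → ℚ) (M Q Q′ : ℕ) : Set where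
  field
    P P′   : ℤ
    rest   : ℕ → ℤ
    det    : P′ ℤ.* + Q ℤ.- P ℤ.* + Q′ ≡ 1ℤ
    1≤rest : ∀ i → 1ℤ ℤ.≤ rest i
    rest≤M : ∀ i → ℤ.∣ rest i ∣ ℕ.≤ M
    tracks : Tracks c P (+ Q) P′ (+ Q′) rest

open Bracket

det-step : ∀ u v P Q P′ Q′ → let P″ = u ℤ.* P′ ℤ.+ P ; Q″ = u ℤ.* Q′ ℤ.+ Q in
  (v ℤ.* P″ ℤ.+ P′) ℤ.* Q″ ℤ.- P″ ℤ.* (v ℤ.* Q″ ℤ.+ Q′) ≡ P′ ℤ.* Q ℤ.- P ℤ.* Q′
det-step = solve-∀

1≤⇒+∣∣ : ∀ {k} → 1ℤ ℤ.≤ k → k ≡ + ℤ.∣ k ∣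
1≤⇒+∣∣ (+≤+ _) = refl

1≤⇒1≤∣∣ : ∀ {k} → 1ℤ ℤ.≤ k → 1 ℕ.≤ ℤ.∣ k ∣
1≤⇒1≤∣∣ (+≤+ p) = p

affine≡ : ∀ {k} → 1ℤ ℤ.≤ k → ∀ m n → k ℤ.* + m ℤ.+ + n ≡ + (ℤ.∣ k ∣ ℕ.* m ℕ.+ n)
affine≡ {k} 1≤k m n = cong (ℤ._+ + n) (trans (cong (ℤ._* + m) (1≤⇒+∣∣ 1≤k)) (sym (ℤ.pos-* ℤ.∣ k ∣ m)))

bracket-step : ∀ {c M Q Q′} → Bracket c M Q Q′ → ∃[ u ] ∃[ v ] 1 ℕ.≤ u × u ℕ.≤ M × 1 ℕ.≤ v × v ℕ.≤ M ×
  Bracket c M (u ℕ.* Q′ ℕ.+ Q) (v ℕ.* (u ℕ.* Q′ ℕ.+ Q) ℕ.+ Q′)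
bracket-step {c} {M} {Q} {Q′} B = ℤ.∣ B .rest 0 ∣ , ℤ.∣ B .rest 1 ∣ ,
  1≤⇒1≤∣∣ (B .1≤rest 0) , B .rest≤M 0 , 1≤⇒1≤∣∣ (B .1≤rest 1) , B .rest≤M 1 , record
    { P      = B .rest 0 ℤ.* B .P′ ℤ.+ B .P
    ; P′     = B .rest 1 ℤ.* (B .rest 0 ℤ.* B .P′ ℤ.+ B .P) ℤ.+ B .P′
    ; rest   = B .rest ∘ suc ∘ suc
    ; det    = subst₂ (λ X X′ → P₂ ℤ.* X ℤ.- P₁ ℤ.* X′ ≡ 1ℤ) Q₁≡ Q₂≡
                 (trans (det-step (B .rest 0) (B .rest 1) (B .P) (+ Q) (B .P′) (+ Q′)) (B .det))
    ; 1≤rest = B .1≤rest ∘ suc ∘ suc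
    ; rest≤M = B .rest≤M ∘ suc ∘ suc
    ; tracks = subst₂ (λ X X′ → Tracks c P₁ X P₂ X′ (B .rest ∘ suc ∘ suc)) Q₁≡ Q₂≡
                 (tracks-step {c} {B .P} {+ Q} {B .P′} {+ Q′} (B .rest) (B .1≤rest ∘ suc) (B .tracks))
    }
  where
  P₁ = B .rest 0 ℤ.* B .P′ ℤ.+ B .P
  P₂ = B .rest 1 ℤ.* P₁ ℤ.+ B .P′
  Q₁≡ : B .rest 0 ℤ.* + Q′ ℤ.+ + Q ≡ + (ℤ.∣ B .rest 0 ∣ ℕ.* Q′ ℕ.+ Q)
  Q₁≡ = affine≡ (B .1≤rest 0) Q′ Q
  Q₂≡ : B .rest 1 ℤ.* (B .rest 0 ℤ.* + Q′ ℤ.+ + Q) ℤ.+ + Q′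
    ≡ + (ℤ.∣ B .rest 1 ∣ ℕ.* (ℤ.∣ B .rest 0 ∣ ℕ.* Q′ ℕ.+ Q) ℕ.+ Q′)
  Q₂≡ = trans (cong (λ X → B .rest 1 ℤ.* X ℤ.+ + Q′) Q₁≡) (affine≡ (B .1≤rest 1) _ Q′)

-- The identity transformation has P/Q = 0/1 and P′/Q′ = 1/0; two steps from it lead to a₀ and a₀ +
-- 1/a₁, whose denominators are positive.
bracket-start : ∀ {M} r → (∀ i → 1ℤ ℤ.≤ r (suc i)) → (∀ i → ℤ.∣ r i ∣ ℕ.≤ M) →
  Bracket (convergent r) M 1 ℤ.∣ r 1 ∣
bracket-start r 1≤r r≤M = record
  { P      = r 0 ℤ.* 1ℤ ℤ.+ 0ℤ
  ; P′     = r 1 ℤ.* (r 0 ℤ.* 1ℤ ℤ.+ 0ℤ) ℤ.+ 1ℤ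
  ; rest   = r ∘ suc ∘ suc
  ; det    = subst₂ (λ X X′ → (r 1 ℤ.* (r 0 ℤ.* 1ℤ ℤ.+ 0ℤ) ℤ.+ 1ℤ) ℤ.* X ℤ.- (r 0 ℤ.* 1ℤ ℤ.+ 0ℤ) ℤ.* X′ ≡ 1ℤ) Q₁≡ Q₂≡
               (det-step (r 0) (r 1) 0ℤ 1ℤ 1ℤ 0ℤ)
  ; 1≤rest = 1≤r ∘ suc
  ; rest≤M = r≤M ∘ suc ∘ suc
  ; tracks = subst₂ (λ X X′ → Tracks (convergent r) (r 0 ℤ.* 1ℤ ℤ.+ 0ℤ) X (r 1 ℤ.* (r 0 ℤ.* 1ℤ ℤ.+ 0ℤ) ℤ.+ 1ℤ) X′ (r ∘ suc ∘ suc)) Q₁≡ Q₂≡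
               (tracks-step {convergent r} {0ℤ} {1ℤ} {1ℤ} {0ℤ} r 1≤r (0 , λ n → identity (convergent r n)))
  }
  where
  identity : ∀ y → y ℚ.* (ι 0ℤ ℚ.* y ℚ.+ ι 1ℤ) ≡ ι 1ℤ ℚ.* y ℚ.+ ι 0ℤ
  identity = solve 1 (λ y → y :* (con 0ℤ :* y :+ con 1ℤ) := con 1ℤ :* y :+ con 0ℤ) refl
  Q₁≡ : r 0 ℤ.* 0ℤ ℤ.+ 1ℤ ≡ 1ℤ
  Q₁≡ = cong (ℤ._+ 1ℤ) (ℤ.*-zeroʳ (r 0))
  Q₂≡ : r 1 ℤ.* (r 0 ℤ.* 0ℤ ℤ.+ 1ℤ) ℤ.+ 0ℤ ≡ + ℤ.∣ r 1 ∣
  Q₂≡ = trans (ℤ.+-identityʳ _) (trans (cong (r 1 ℤ.*_) Q₁≡) (trans (ℤ.*-identityʳ (r 1)) (1≤⇒+∣∣ (1≤r 0))))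

cube : ℕ → ℕ
cube k = k ℕ.* (k ℕ.* k)

-- With k = M + 1, the bounds u, v ≤ M become suc u, suc v ≤ k.
step-sizes : ∀ {k Q Q′ u v} → 1 ℕ.≤ Q → Q ℕ.≤ Q′ → Q′ ℕ.≤ k ℕ.* Q →
  1 ℕ.≤ u → u ℕ.< k → 1 ℕ.≤ v → v ℕ.< k → let Q₁ = u ℕ.* Q′ ℕ.+ Q ; Q₂ = v ℕ.* Q₁ ℕ.+ Q′ in
  suc Q ℕ.≤ Q₁ × Q₁ ℕ.≤ Q₂ × Q₂ ℕ.≤ k ℕ.* Q₁ × Q₂ ℕ.≤ cube k ℕ.* Q
step-sizes {k} {Q} {Q′} {u} {v} 1≤Q Q≤Q′ Q′≤kQ 1≤u u<k 1≤v v<k =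
  ℕ.+-monoˡ-≤ Q (ℕ.≤-trans 1≤Q (ℕ.≤-trans Q≤Q′ Q′≤uQ′)) ,
  ℕ.≤-trans (ℕ.m≤n*m Q₁ v {{ℕ.>-nonZero 1≤v}}) (ℕ.m≤m+n _ Q′) ,
  Q₂≤kQ₁ ,
  (begin
    v ℕ.* Q₁ ℕ.+ Q′                ≤⟨ Q₂≤kQ₁ ⟩
    k ℕ.* Q₁                       ≤⟨ ℕ.*-monoʳ-≤ k Q₁≤kkQ ⟩
    k ℕ.* (k ℕ.* (k ℕ.* Q))        ≡⟨ cong (k ℕ.*_) (ℕ.*-assoc k k Q) ⟨
    k ℕ.* (k ℕ.* k ℕ.* Q)          ≡⟨ ℕ.*-assoc k (k ℕ.* k) Q ⟨
    k ℕ.* (k ℕ.* k) ℕ.* Q          ∎)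
  where
  open ℕ.≤-Reasoning
  Q₁ = u ℕ.* Q′ ℕ.+ Q
  absorb : ∀ {w x y} → w ℕ.< k → x ℕ.≤ y → w ℕ.* y ℕ.+ x ℕ.≤ k ℕ.* y
  absorb {w} {x} {y} w<k x≤y = begin
    w ℕ.* y ℕ.+ x   ≤⟨ ℕ.+-monoʳ-≤ (w ℕ.* y) x≤y ⟩
    w ℕ.* y ℕ.+ y   ≡⟨ ℕ.+-comm (w ℕ.* y) y ⟩
    suc w ℕ.* y     ≤⟨ ℕ.*-monoˡ-≤ y w<k ⟩
    k ℕ.* y         ∎
  Q′≤uQ′ : Q′ ℕ.≤ u ℕ.* Q′
  Q′≤uQ′ = ℕ.m≤n*m Q′ u {{ℕ.>-nonZero 1≤u}}
  Q₂≤kQ₁ : v ℕ.* Q₁ ℕ.+ Q′ ℕ.≤ k ℕ.* Q₁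
  Q₂≤kQ₁ = absorb v<k (ℕ.≤-trans Q′≤uQ′ (ℕ.m≤m+n _ Q))
  Q₁≤kkQ : Q₁ ℕ.≤ k ℕ.* (k ℕ.* Q)
  Q₁≤kkQ = ℕ.≤-trans (absorb u<k Q≤Q′) (ℕ.*-monoʳ-≤ k Q′≤kQ)

BracketWithin : (ℕ → ℚ) → (M k n : ℕ) → Set
BracketWithin c M k n = ∃[ Q ] ∃[ Q′ ]
  n ℕ.≤ Q × Q ℕ.≤ Q′ × Q′ ℕ.≤ k ℕ.* Q × Q′ ℕ.≤ cube k ℕ.* n × Bracket c M Q Q′

-- The bracket advances only when Q equals the old scale. The new Q′ is at most (M + 1)³ Q, hence at
-- most (M + 1)³ times that scale.
bracket-grow : ∀ {c M n} → BracketWithin c M (suc M) (suc n) → BracketWithin c M (suc M) (suc (suc n))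
bracket-grow {c} {M} {n} (Q , Q′ , n<Q , Q≤Q′ , Q′≤kQ , Q′≤k³n , B) = by-cases (ℕ.m≤n⇒m<n∨m≡n n<Q)
  where
  k³n≤ : cube (suc M) ℕ.* suc n ℕ.≤ cube (suc M) ℕ.* suc (suc n)
  k³n≤ = ℕ.*-monoʳ-≤ (cube (suc M)) (ℕ.n≤1+n (suc n))
  by-cases : suc n ℕ.< Q ⊎ suc n ≡ Q → BracketWithin c M (suc M) (suc (suc n))
  by-cases (inj₁ 1+n<Q) = Q , Q′ , 1+n<Q , Q≤Q′ , Q′≤kQ , ℕ.≤-trans Q′≤k³n k³n≤ , B
  by-cases (inj₂ 1+n≡Q) =
    let u , v , 1≤u , u≤M , 1≤v , v≤M , B′ = bracket-step B
        Q<Q₁ , Q₁≤Q₂ , Q₂≤kQ₁ , Q₂≤k³Q =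
          step-sizes {suc M} {Q} {Q′} (ℕ.≤-trans (s≤s z≤n) n<Q) Q≤Q′ Q′≤kQ 1≤u (s≤s u≤M) 1≤v (s≤s v≤M)
    in u ℕ.* Q′ ℕ.+ Q , v ℕ.* (u ℕ.* Q′ ℕ.+ Q) ℕ.+ Q′ ,
       subst (λ q → suc q ℕ.≤ u ℕ.* Q′ ℕ.+ Q) (sym 1+n≡Q) Q<Q₁ , Q₁≤Q₂ , Q₂≤kQ₁ ,
       ℕ.≤-trans (subst (λ q → v ℕ.* (u ℕ.* Q′ ℕ.+ Q) ℕ.+ Q′ ℕ.≤ cube (suc M) ℕ.* q) (sym 1+n≡Q) Q₂≤k³Q) k³n≤ , B′

brackets-linear : ∀ {M} r → (∀ i → 1ℤ ℤ.≤ r (suc i)) → (∀ i → ℤ.∣ r i ∣ ℕ.≤ M) → ∀ n →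
  BracketWithin (convergent r) M (suc M) (suc n)
brackets-linear {M} r 1≤r r≤M zero = 1 , ℤ.∣ r 1 ∣ , ℕ.≤-refl , 1≤⇒1≤∣∣ (1≤r 0) ,
  ℕ.≤-trans (r≤M 1) M≤k , ℕ.≤-trans (r≤M 1) (ℕ.≤-trans M≤k (ℕ.*-monoˡ-≤ 1 (ℕ.m≤m*n (suc M) (suc M ℕ.* suc M)))) ,
  bracket-start r 1≤r r≤M
  where
  M≤k : M ℕ.≤ suc M ℕ.* 1
  M≤k = subst (M ℕ.≤_) (sym (ℕ.*-identityʳ (suc M))) (ℕ.n≤1+n M)
brackets-linear r 1≤r r≤M (suc n) = bracket-grow (brackets-linear r 1≤r r≤M n)

fraction : ℤ → ℕ → ℚ
fraction P Q = ι P ℚ.* recip (ι (+ Q))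

fraction-* : ∀ P {Q} → 1 ℕ.≤ Q → fraction P Q ℚ.* ι (+ Q) ≡ ι P
fraction-* P {Q} 1≤Q = trans (ℚ.*-assoc (ι P) _ _)
  (trans (cong (ι P ℚ.*_) (recip-inverse (0<ι (+≤+ 1≤Q)))) (ℚ.*-identityʳ (ι P)))

module _ {c : ℕ → ℚ} {M Q Q′ : ℕ} (B : Bracket c M Q Q′) (1≤Q : 1 ℕ.≤ Q) (1≤Q′ : 1 ℕ.≤ Q′) where

  private
    tail : ℕ → ℚ
    tail = convergent (B .rest)

    c′ : ℕ → ℚ
    c′ n = c (B .tracks .proj₁ ℕ.+ n)

    D : ℕ → ℚ
    D n = ι (+ Q′) ℚ.* tail n ℚ.+ ι (+ Q)

    0<tail : ∀ n → 0ℚ ℚ.< tail n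
    0<tail = 0<convergent (B .1≤rest)

    0<* : ∀ {p q} → 0ℚ ℚ.< p → 0ℚ ℚ.< q → 0ℚ ℚ.< p ℚ.* q
    0<* {p} {q} 0<p 0<q = subst (ℚ._< p ℚ.* q) (ℚ.*-zeroʳ p) (ℚ.*-monoʳ-<-pos p {{ℚ.positive 0<p}} 0<q)

    0<D : ∀ n → 0ℚ ℚ.< D n
    0<D n = 0<+ (0<* (0<ι (+≤+ 1≤Q′)) (0<tail n)) (0<ι (+≤+ 1≤Q))

    ι-det : ι (B .P′) ℚ.* ι (+ Q) ℚ.- ι (B .P) ℚ.* ι (+ Q′) ≡ 1ℚ
    ι-det = trans (cong₂ ℚ._-_ (sym (ι-* (B .P′) (+ Q))) (sym (ι-* (B .P) (+ Q′))))
      (trans (sym (ι-- (B .P′ ℤ.* + Q) (B .P ℤ.* + Q′))) (cong ι (B .det)))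

  -- For y > 0 the value (P′ y + P) / (Q′ y + Q) lies between P/Q and P′/Q′: after cross
  -- multiplication the differences are y times the determinant here and the determinant itself in
  -- `bracket-upper`.
  bracket-lower : ∀ n → fraction (B .P) Q ℚ.≤ c′ n
  bracket-lower n = *-cancelʳ-≤ (0<* (0<ι (+≤+ 1≤Q)) (0<D n))
    (subst₂ ℚ._≤_ (sym lhs) (sym rhs)
      (≤-by (trans (ℚ.+-identityʳ (tail n)) (sym difference)) (ℚ.<⇒≤ (0<tail n))))
    where
    p = ι (B .P)
    p′ = ι (B .P′)
    q = ι (+ Q)
    q′ = ι (+ Q′)
    lhs : fraction (B .P) Q ℚ.* (q ℚ.* D n) ≡ p ℚ.* D n
    lhs = trans (sym (ℚ.*-assoc (fraction (B .P) Q) q (D n))) (cong (ℚ._* D n) (fraction-* (B .P) 1≤Q))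
    rhs : c′ n ℚ.* (q ℚ.* D n) ≡ (p′ ℚ.* tail n ℚ.+ p) ℚ.* q
    rhs = trans (reorder (c′ n) q (D n)) (cong (ℚ._* q) (B .tracks .proj₂ n))
      where
      reorder : ∀ c q D → c ℚ.* (q ℚ.* D) ≡ c ℚ.* D ℚ.* q
      reorder = solve 3 (λ c q D → c :* (q :* D) := c :* D :* q) refl
    difference : (p′ ℚ.* tail n ℚ.+ p) ℚ.* q ℚ.- p ℚ.* D n ≡ tail n
    difference = trans (collect p q p′ q′ (tail n)) (trans (cong (tail n ℚ.*_) ι-det) (ℚ.*-identityʳ (tail n)))
      where
      collect : ∀ p q p′ q′ y →
        (p′ ℚ.* y ℚ.+ p) ℚ.* q ℚ.- p ℚ.* (q′ ℚ.* y ℚ.+ q) ≡ y ℚ.* (p′ ℚ.* q ℚ.- p ℚ.* q′)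
      collect = solve 5 (λ p q p′ q′ y → (p′ :* y :+ p) :* q :- p :* (q′ :* y :+ q) := y :* (p′ :* q :- p :* q′)) refl

  bracket-upper : ∀ n → c′ n ℚ.≤ fraction (B .P′) Q′
  bracket-upper n = *-cancelʳ-≤ (0<* (0<ι (+≤+ 1≤Q′)) (0<D n))
    (subst₂ ℚ._≤_ (sym lhs) (sym rhs)
      (≤-by (trans (ℚ.+-identityʳ 1ℚ) (sym difference)) (ℚ.<⇒≤ (ℚ.positive⁻¹ 1ℚ))))
    where
    p = ι (B .P)
    p′ = ι (B .P′)
    q = ι (+ Q)
    q′ = ι (+ Q′)
    rhs : fraction (B .P′) Q′ ℚ.* (q′ ℚ.* D n) ≡ p′ ℚ.* D n
    rhs = trans (sym (ℚ.*-assoc (fraction (B .P′) Q′) q′ (D n))) (cong (ℚ._* D n) (fraction-* (B .P′) 1≤Q′))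
    lhs : c′ n ℚ.* (q′ ℚ.* D n) ≡ (p′ ℚ.* tail n ℚ.+ p) ℚ.* q′
    lhs = trans (reorder (c′ n) q′ (D n)) (cong (ℚ._* q′) (B .tracks .proj₂ n))
      where
      reorder : ∀ c q D → c ℚ.* (q ℚ.* D) ≡ c ℚ.* D ℚ.* q
      reorder = solve 3 (λ c q D → c :* (q :* D) := c :* D :* q) refl
    difference : p′ ℚ.* D n ℚ.- (p′ ℚ.* tail n ℚ.+ p) ℚ.* q′ ≡ 1ℚ
    difference = trans (collect p q p′ q′ (tail n)) ι-det
      where
      collect : ∀ p q p′ q′ y →
        p′ ℚ.* (q′ ℚ.* y ℚ.+ q) ℚ.- (p′ ℚ.* y ℚ.+ p) ℚ.* q′ ≡ p′ ℚ.* q ℚ.- p ℚ.* q′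
      collect = solve 5 (λ p q p′ q′ y → p′ :* (q′ :* y :+ q) :- (p′ :* y :+ p) :* q′ := p′ :* q :- p :* q′) refl

-- Farey neighbours for the heights of a Sturmian word

module _ {α : ℝ} (irrational : Irrational α) (P e : ℤ) (Q j : ℕ) (1≤Q : 1 ℕ.≤ Q) where

  private
    q = fraction P Q

    scale : ι (+ j) ℚ.* q ℚ.* ι (+ Q) ≡ ι (P ℤ.* + j)
    scale = trans (ℚ.*-assoc (ι (+ j)) q (ι (+ Q))) (trans (cong (ι (+ j) ℚ.*_) (fraction-* P 1≤Q))
      (trans (ℚ.*-comm (ι (+ j)) (ι P)) (sym (ι-* P (+ j)))))

    scale-e : ι e ℚ.* ι (+ Q) ≡ ι (+ Q ℤ.* e)
    scale-e = trans (ℚ.*-comm (ι e) (ι (+ Q))) (sym (ι-* (+ Q) e))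

    from-q : ∀ {x} → x ≤ fromℚ (ι (+ j) ℚ.* q) → x ≤ j • fromℚ q
    from-q {x} = ≤-shift {x} {fromℚ (ι (+ j) ℚ.* q)} {x} {j • fromℚ q} (λ n → cong (ℚ._- seq x n) (sym (seq-• j (fromℚ q) n)))

    from-q′ : ∀ {x} → fromℚ (ι (+ j) ℚ.* q) ≤ x → j • fromℚ q ≤ x
    from-q′ {x} = ≤-shift {fromℚ (ι (+ j) ℚ.* q)} {x} {j • fromℚ q} {x} (λ n → cong (λ p → seq x n ℚ.- p) (sym (seq-• j (fromℚ q) n)))

    to-q : ∀ {x} → x ≤ j • fromℚ q → x ≤ fromℚ (ι (+ j) ℚ.* q)
    to-q {x} = ≤-shift {x} {j • fromℚ q} {x} {fromℚ (ι (+ j) ℚ.* q)} (λ n → cong (ℚ._- seq x n) (seq-• j (fromℚ q) n))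

    to-q′ : ∀ {x} → j • fromℚ q ≤ x → fromℚ (ι (+ j) ℚ.* q) ≤ x
    to-q′ {x} = ≤-shift {j • fromℚ q} {x} {fromℚ (ι (+ j) ℚ.* q)} {x} (λ n → cong (λ p → seq x n ℚ.- p) (seq-• j (fromℚ q) n))

    ιQ-nonNeg : ℚ.NonNegative (ι (+ Q))
    ιQ-nonNeg = ℚ.nonNegative (ι-mono {0ℤ} {+ Q} (+≤+ z≤n))

    •-cancel-≤′ : ∀ {x y} j → 1 ℕ.≤ j → j • x ≤ j • y → x ≤ y
    •-cancel-≤′ {x} {y} (suc j) _ = •-cancel-≤ {x} {y} j

    equal⇒ : + Q ℤ.* e ≡ P ℤ.* + j → ι e ≡ ι (+ j) ℚ.* q
    equal⇒ eq = ℚ.≤-antisym (*-cancelʳ-≤ {ι e} {ι (+ j) ℚ.* q} 0<ιQ (ℚ.≤-reflexive same)) (*-cancelʳ-≤ {ι (+ j) ℚ.* q} {ι e} 0<ιQ (ℚ.≤-reflexive (sym same)))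
      where
      0<ιQ = 0<ι {+ Q} (+≤+ 1≤Q)
      same : ι e ℚ.* ι (+ Q) ≡ ι (+ j) ℚ.* q ℚ.* ι (+ Q)
      same = trans scale-e (trans (cong ι eq) (sym scale))

    no-equality : (j ≡ 0 → e ≢ 0ℤ) → (1 ℕ.≤ j → + Q ℤ.* e ≢ P ℤ.* + j) → + Q ℤ.* e ≢ P ℤ.* + j
    no-equality e≢0 distinct = by-cases j refl
      where
      by-cases : ∀ i → i ≡ j → + Q ℤ.* e ≢ P ℤ.* + j
      by-cases (suc i) refl = distinct (s≤s z≤n)
      by-cases zero refl Qe≡0 with ℤ.i*j≡0⇒i≡0∨j≡0 (+ Q) (trans Qe≡0 (ℤ.*-zeroʳ P))
      ... | inj₁ Q≡0 = ℕ.<⇒≢ 1≤Q (sym (ℤ.+-injective Q≡0))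
      ... | inj₂ e≡0 = e≢0 refl e≡0

  -- P j ≤ Q e is immediate. Equality would force α = P/Q if j > 0, and e = 0 if j = 0; in the
  -- application e is then 1.
  fraction-below : (j ≡ 0 → e ≢ 0ℤ) → fromℚ q ≤ α → j • α ≤ fromℤ e → 0ℤ ℤ.≤ + Q ℤ.* e ℤ.- P ℤ.* + j ℤ.- 1ℤ
  fraction-below e≢0 q≤α jα≤e = [ (λ eq → ⊥-elim (no-equality e≢0 strict (ℤ.i-j≡0⇒i≡j _ _ eq))) , (λ p → p) ]′
    (zero∨positive (ℤ.i≤j⇒0≤j-i (ι-cancel {P ℤ.* + j} {+ Q ℤ.* e} (subst₂ ℚ._≤_ scale scale-e
      (ℚ.*-monoʳ-≤-nonNeg (ι (+ Q)) {{ιQ-nonNeg}} (fromℚ-cancel-≤ {ι (+ j) ℚ.* q} {ι e} (to-q′ {fromℤ e} jq≤e)))))))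
    where
    jq≤e : j • fromℚ q ≤ fromℤ e
    jq≤e = ≤-trans {j • fromℚ q} {j • α} {fromℤ e} (•-mono-≤ {fromℚ q} {α} j q≤α) jα≤e
    strict : 1 ℕ.≤ j → + Q ℤ.* e ≢ P ℤ.* + j
    strict 1≤j eq = irrational (q , •-cancel-≤′ {α} {fromℚ q} j 1≤j
      (from-q {j • α} (subst (λ x → j • α ≤ fromℚ x) (equal⇒ eq) jα≤e)) , q≤α)

  fraction-above : (j ≡ 0 → e ≢ 0ℤ) → α ≤ fromℚ q → fromℤ e ≤ j • α → 0ℤ ℤ.≤ P ℤ.* + j ℤ.- + Q ℤ.* e ℤ.- 1ℤ
  fraction-above e≢0 α≤q e≤jα = [ (λ eq → ⊥-elim (no-equality e≢0 strict (sym (ℤ.i-j≡0⇒i≡j _ _ eq)))) , (λ p → p) ]′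
    (zero∨positive (ℤ.i≤j⇒0≤j-i (ι-cancel {+ Q ℤ.* e} {P ℤ.* + j} (subst₂ ℚ._≤_ scale-e scale
      (ℚ.*-monoʳ-≤-nonNeg (ι (+ Q)) {{ιQ-nonNeg}} (fromℚ-cancel-≤ {ι e} {ι (+ j) ℚ.* q} (to-q {fromℤ e} e≤jq)))))))
    where
    e≤jq : fromℤ e ≤ j • fromℚ q
    e≤jq = ≤-trans {fromℤ e} {j • α} {j • fromℚ q} e≤jα (•-mono-≤ {α} {fromℚ q} j α≤q)
    strict : 1 ℕ.≤ j → + Q ℤ.* e ≢ P ℤ.* + j
    strict 1≤j eq = irrational (q , α≤q , •-cancel-≤′ {fromℚ q} {α} j 1≤j
      (from-q′ {j • α} (subst (λ x → fromℚ x ≤ j • α) (equal⇒ eq) e≤jα)))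

sturmian-farey : ∀ {α s} → 0ℝ < α → α < 1ℝ → Irrational α → ((r , _) : BoundedPartialQuotients α) → IsSturmian α s →
  ∃[ M ] WithinLinear (λ Q Q′ → ∃[ P ] ∃[ P′ ] Farey (height s) P Q P′ Q′) (cube (suc M))
sturmian-farey {α} {s} 0<α α<1 irrational (r , (1≤r , conv) , M , r≤M) (ρ , ρ∈ , word) = M , pairs
  where
  no-increment : ∀ i → height s (i ℕ.+ 0) ℤ.- height s i ≡ 0ℤ
  no-increment i = height-increment s i 0
  e≢0 : ∀ i → height s (i ℕ.+ 0) ℤ.- height s i ℤ.+ 1ℤ ≢ 0ℤ
  e≢0 i eq with trans (sym (cong (ℤ._+ 1ℤ) (no-increment i))) eq
  ... | ()
  e≢0′ : ∀ i → height s (i ℕ.+ 0) ℤ.- height s i ℤ.- 1ℤ ≢ 0ℤ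
  e≢0′ i eq with trans (sym (cong (ℤ._- 1ℤ) (no-increment i))) eq
  ... | ()
  pairs : WithinLinear (λ Q Q′ → ∃[ P ] ∃[ P′ ] Farey (height s) P Q P′ Q′) (cube (suc M))
  pairs (suc n) _ =
    let Q , Q′ , n<Q , Q≤Q′ , _ , Q′≤Kn , B = brackets-linear r 1≤r r≤M n
        n<Q′ = ℕ.≤-trans n<Q Q≤Q′
        1≤Q  = ℕ.≤-trans (s≤s z≤n) n<Q
        1≤Q′ = ℕ.≤-trans (s≤s z≤n) n<Q′
    in Q , Q′ , n<Q , n<Q′ , ℕ.≤-trans Q≤Q′ Q′≤Kn , Q′≤Kn , B .P , B .P′ , record
      { det   = B .det
      ; lower = λ i j → fraction-below {α} irrational (B .P) _ Q j 1≤Q (λ { refl → e≢0 i })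
          (limit-≥ {convergent r} {α} conv (B .tracks .proj₁) (bracket-lower B 1≤Q 1≤Q′))
          (increment-bounds {α} {ρ} 0<α α<1 {s} ρ∈ word i j .proj₁)
      ; upper = λ i j → fraction-above {α} irrational (B .P′) _ Q′ j 1≤Q′ (λ { refl → e≢0′ i })
          (limit-≤ {convergent r} {α} conv (B .tracks .proj₁) (bracket-upper B 1≤Q 1≤Q′))
          (increment-bounds {α} {ρ} 0<α α<1 {s} ρ∈ word i j .proj₂)
      }

-- The quadratic lower bound over the reals

•-recip-≤ : ∀ K .{{_ : ℕ.NonZero K}} k S → k ℕ.≤ K ℕ.* S → k • fromℚ (recip (ι (+ K))) ≤ fromℕ S
•-recip-≤ K k S k≤KS = ≤-shift {fromℚ (ι (+ k) ℚ.* C)} {fromℕ S} {k • fromℚ C} {fromℕ S}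
  (λ n → cong (λ p → ι (+ S) ℚ.- p) (sym (seq-• k (fromℚ C) n)))
  (fromℚ-mono-≤ {ι (+ k) ℚ.* C} {ι (+ S)} (*-cancelʳ-≤ {ι (+ k) ℚ.* C} {ι (+ S)} 0<K
    (subst₂ ℚ._≤_ (sym lhs) rhs (ι-mono {+ k} {+ (K ℕ.* S)} (+≤+ k≤KS)))))
  where
  C = recip (ι (+ K))
  0<K : 0ℚ ℚ.< ι (+ K)
  0<K = 0<ι {+ K} (+≤+ (ℕ.>-nonZero⁻¹ K))
  lhs : ι (+ k) ℚ.* C ℚ.* ι (+ K) ≡ ι (+ k)
  lhs = trans (ℚ.*-assoc (ι (+ k)) C (ι (+ K)))
    (trans (cong (ι (+ k) ℚ.*_) (recip-inverse 0<K)) (ℚ.*-identityʳ (ι (+ k))))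
  rhs : ι (+ (K ℕ.* S)) ≡ ι (+ S) ℚ.* ι (+ K)
  rhs = trans (cong ι (ℤ.pos-* K S)) (trans (ι-* (+ K) (+ S)) (ℚ.*-comm (ι (+ K)) (ι (+ S))))

0<fromℚ : ∀ {p} → 0ℚ ℚ.< p → 0ℝ < fromℚ p
0<fromℚ {p} 0<p = p , 0<p , 0 , λ _ _ → ℚ.≤-reflexive (ℚ.+-identityˡ p)

theorem3 : (α : ℝ) → 0ℝ < α → α < 1ℝ → Irrational α → BoundedPartialQuotients α →
    (s : InfiniteWord) → IsSturmian α s →
    ∃[ ASF ] IsASF s ASF ×
    (∃[ C ] 0ℝ < C × (∃[ N ] ∀ n → N ℕ.≤ n →
    (n ℕ.^ 2) • C ≤ fromℕ (sum (map ASF (upTo (ℕ.suc n))))))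
theorem3 α 0<α α<1 irrational bounded s sturmian =
  let M , farey = sturmian-farey {α} {s} 0<α α<1 irrational bounded sturmian
      k = suc M
      instance _ = ℕ.m*n≢0 k k
               _ = ℕ.m*n≢0 k (k ℕ.* k)
               _ = ℕ.m*n≢0 1024 (cube k)
      ASF = asf s (cube k) farey
      -- With (M + 1)³ for the ratio of the neighbours to their scale, C is 1 / (1024 (M + 1)³), and
      -- n ≥ 8 (M + 1)³ is sufficiently large.
      K = 1024 ℕ.* cube k
  in ASF , asf-isASF s (cube k) farey , fromℚ (recip (ι (+ K))) ,
     0<fromℚ (0<recip (0<ι (+≤+ (ℕ.>-nonZero⁻¹ K)))) ,
     8 ℕ.* cube k , λ n N≤n → •-recip-≤ K (n ℕ.^ 2) _
       (subst₂ (λ n² S → n² ℕ.≤ K ℕ.* S) (cong (n ℕ.*_) (sym (ℕ.*-identityʳ n))) (sym (sum-map-upTo ASF (suc n)))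
         (asf-sum-quadratic s (cube k) farey n N≤n))
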